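{- Let $\theta = \frac{\sqrt{10}-2}{3}$ and $\rho = \frac{\sqrt{10}-1}{3}$, and let $\mathbf s' = s'_1s'_2\ldots$ be the infinite word over $\{0,1\}$ given by $s'_n = \lceil (n+1)\theta + \rho\rceil - \lceil n\theta+\rho\rceil$ for $n \ge 1$ (the Sturmian word of slope $\theta$ and intercept $\rho$). Then $\mathrm{rep}(\mathbf s') = \sqrt{10} - \frac32$.
   Context: With $x_i^j = x_i\cdots x_j$, for an infinite word $\mathbf x$, $r(n,\mathbf x) = \min\{ m \ge 1 : x_i^{i+n-1} = x_{m-n+1}^{m} \text{ for some } i \text{ with } 1 \le i \le m-n\}$, and $\mathrm{rep}(\mathbf x) = \liminf_{n\to+\infty} r(n,\mathbf x)/n$. -}

module Defs where

open import Data.Nat as ℕ using (ℕ; zero; suc; _∸_)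
open import Data.Integer as ℤ using (ℤ; +_; _-_; _*_; _+_)
open import Data.Product using (Σ; _×_; ∃-syntax)
open import Data.Sum using (_⊎_)
open import Relation.Binary.PropositionalEquality using (_≡_)

-- Exact comparisons between an integer u and a·√10 (a : ℕ), using only
-- integer arithmetic (valid since a·√10 ≥ 0).
-- u ≤ a√10
_≤√10·_ : ℤ → ℕ → Set
u ≤√10· a = (u ℤ.≤ + 0) ⊎ (u * u ℤ.≤ + 10 * (+ a * + a))

_<√10·_ : ℤ → ℕ → Set
u <√10· a = (u ℤ.< + 0) ⊎ (u * u ℤ.< + 10 * (+ a * + a))

_√10·≤_ : ℕ → ℤ → Set
a √10·≤ u = (+ 0 ℤ.≤ u) × (+ 10 * (+ a * + a) ℤ.≤ u * u)

_√10·<_ : ℕ → ℤ → Set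
a √10·< u = (+ 0 ℤ.≤ u) × (+ 10 * (+ a * + a) ℤ.< u * u)

-- k = ⌈ (a√10 + b) / 3 ⌉,  i.e.  k - 1 < (a√10 + b)/3 ≤ k,
-- i.e.  3k - 3 - b < a√10 ≤ 3k - b.
IsCeil : ℕ → ℤ → ℤ → Set
IsCeil a b k = ((+ 3 * k - + 3 - b) <√10· a) × (a √10·≤ (+ 3 * k - b))

-- n θ + ρ = ((n+1)√10 - (2n+1)) / 3  for θ = (√10-2)/3, ρ = (√10-1)/3.
-- c is the sequence n ↦ ⌈ n θ + ρ ⌉.
IsCeilSeq : (ℕ → ℤ) → Set
IsCeilSeq c = ∀ n → IsCeil (suc n) (ℤ.- (+ (2 ℕ.* n ℕ.+ 1))) (c n)

-- The Sturmian word s' (letters at indices n ≥ 1; index 0 unused).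
sturm : (ℕ → ℤ) → ℕ → ℤ
sturm c n = c (suc n) - c n

-- Infinite words are functions ℕ → A, with letters x 1, x 2, ... (x 0 ignored).
-- Occ x n m : ∃ i with 1 ≤ i ≤ m - n and x_i^{i+n-1} = x_{m-n+1}^m.
Occ : {A : Set} → (ℕ → A) → ℕ → ℕ → Set
Occ x n m = ∃[ i ] ((1 ℕ.≤ i) × (i ℕ.+ n ℕ.≤ m) ×
              (∀ j → j ℕ.< n → x (i ℕ.+ j) ≡ x (m ∸ n ℕ.+ 1 ℕ.+ j)))

IsR : {A : Set} → (ℕ → A) → ℕ → ℕ → Set
IsR x n m = (1 ℕ.≤ m) × Occ x n m × (∀ m' → 1 ℕ.≤ m' → Occ x n m' → m ℕ.≤ m')

-- rep(x) = √10 - 3/2, i.e. liminf_{n→∞} r(n,x)/n = √10 - 3/2, stated as: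
--  (i) for every rational p/q < √10 - 3/2 (q > 0), eventually r(n,x)/n > p/q;
--  (ii) for every rational p/q > √10 - 3/2 (q > 0), r(n,x)/n < p/q for infinitely many n.
-- p/q < √10 - 3/2  ⇔  2p + 3q < 2q√10.
RepIsSqrt10MinusThreeHalves : {A : Set} → (ℕ → A) → Set
RepIsSqrt10MinusThreeHalves x =
  (∀ (p : ℤ) (q : ℕ) → 1 ℕ.≤ q → ((+ 2 * p + + (3 ℕ.* q)) <√10· (2 ℕ.* q)) →
     ∃[ N ] ∀ n → N ℕ.≤ n → 1 ℕ.≤ n → ∀ m → IsR x n m → p * + n ℤ.< + (q ℕ.* m))
  ×
  (∀ (p : ℤ) (q : ℕ) → 1 ℕ.≤ q → ((2 ℕ.* q) √10·< (+ 2 * p + + (3 ℕ.* q))) →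
     ∀ N → ∃[ n ] ((N ℕ.≤ n) × (1 ℕ.≤ n) × ∃[ m ] (IsR x n m × (+ (q ℕ.* m) ℤ.< p * + n))))

{-# OPTIONS --safe #-}

-- Put f(y, e) = y − e√10.  The points (3 c(m) + 2m + 1, m + 1) lie in the coset
-- y ≡ 2e + 2 (mod 3) of the lattice L : y ≡ 2e (mod 3), with f in [0, 3).  A
-- repetition with first occurrence at i, shift d and length n means that, for some
-- D = (w, d) in L with f(D) > 0, no coset point P of height e in (i, i + n + 1]
-- satisfies f(P) < 0 < f(P + D) (with signs reversed if f(D) < 0).
--
-- The map M(y, e) = (3y + 10e, y + 3e) preserves L and the coset and multiplies f
-- by 3 − √10, so up to replacing the height e by a linear form b y + a e there are
-- only four one-sided best approximations R to consider.  For each of them an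
-- explicit first hit P and the bound h(R) + h(V) on the gaps between hits (V being
-- the next approximation from the other side) give (i + d − 1)/n ≥ 2/3, except
-- when R = (5, 1), P = (6, 2) and i < h(P).  There the ratio (5b + a)/(6b + 2a) of
-- heights tends to √10 − 5/2, and this value is approached with i = 1, d = 5b + a
-- and n = 6b + 2a − 3.
module Submission where

open import Defs
open import Data.Empty using (⊥; ⊥-elim)
open import Data.Integer using (ℤ; +_; -[1+_]; _+_; _*_; _-_; -_; _≤_; _<_; ∣_∣; +≤+; +<+; -<+; 0ℤ)
import Data.Integer.Properties as ℤₚ
open import Data.Integer.Tactic.RingSolver using (solve)
open import Data.List.Base using (_∷_; [])
open import Data.Nat as ℕ using (ℕ; zero; suc)
import Data.Nat.Properties as ℕₚ
open import Data.Product using (_×_; _,_; ∃-syntax; proj₁; proj₂)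
open import Data.Sum using (_⊎_; inj₁; inj₂)
open import Relation.Binary.Definitions using (Tri; tri<; tri≈; tri>)
open import Relation.Binary.PropositionalEquality using (_≡_; refl; sym; trans; cong; cong₂; subst; subst₂)
open import Relation.Nullary using (yes; no)
open import Relation.Nullary.Decidable using (True; toWitness; map′; _×-dec_)
open import Relation.Unary using (Decidable)

-- Linear arithmetic over ℤ by exhibiting nonnegative combinations

infixl 6 _⊕_
infixl 7 _⊛_ _⊗_

_⊕_ : ∀ {u v} → 0ℤ ≤ u → 0ℤ ≤ v → 0ℤ ≤ u + v
_⊕_ = ℤₚ.+-mono-≤

_⊗_ : ∀ {u v} → 0ℤ ≤ u → 0ℤ ≤ v → 0ℤ ≤ u * v
_⊗_ {+ m} {+ n} _ _ = subst (0ℤ ≤_) (ℤₚ.pos-* m n) (+≤+ ℕ.z≤n)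

_⊛_ : ∀ n {u} → 0ℤ ≤ u → 0ℤ ≤ + n * u
n ⊛ p = +≤+ {n = n} ℕ.z≤n ⊗ p

nonNeg : ∀ n → 0ℤ ≤ + n
nonNeg n = +≤+ ℕ.z≤n

square≥0 : ∀ u → 0ℤ ≤ u * u
square≥0 (+ n) = nonNeg n ⊗ nonNeg n
square≥0 -[1+ n ] = nonNeg _

≤⇒diff : ∀ {x y} → x ≤ y → 0ℤ ≤ y - x
≤⇒diff = ℤₚ.i≤j⇒0≤j-i

<⇒diff : ∀ {x y} → x < y → 0ℤ ≤ y - (+ 1 + x)
<⇒diff p = ℤₚ.i≤j⇒0≤j-i (ℤₚ.i<j⇒suc[i]≤j p)

by≤ : ∀ {x y e} → 0ℤ ≤ e → y - x ≡ e → x ≤ y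
by≤ p eq = ℤₚ.0≤i-j⇒j≤i (subst (0ℤ ≤_) (sym eq) p)

by< : ∀ {x y e} → 0ℤ ≤ e → y - (+ 1 + x) ≡ e → x < y
by< p eq = ℤₚ.suc[i]≤j⇒i<j (by≤ p eq)

-- Certificates in the style of Farkas: a refutation is a nonnegative combination of hypotheses, and
-- of products of them, that the ring solver reduces to -1. Since `<⇒diff` spends 1 on each strict
-- inequality, the trailing `nonNeg k` terms restore the constants.
by⊥ : ∀ {e} → 0ℤ ≤ e → e ≡ - (+ 1) → ⊥
by⊥ p refl with () ← p

<-≥-cases : ∀ x y → x < y ⊎ y ≤ x
<-≥-cases x y with x ℤₚ.<? y
... | yes p = inj₁ p
... | no p  = inj₂ (ℤₚ.≮⇒≥ p)

-- Signs in ℤ[√10]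

-- Pos y a means y − a√10 > 0.  The step is multiplication by the unit
-- 3 + √10 > 1, whose conjugate has absolute value < 1: iterating it brings
-- every positive element into the quadrant of nonnegative coordinates.
data Pos : ℤ → ℤ → Set where
  quadrant : ∀ {y a} → 0ℤ < y → a ≤ 0ℤ → Pos y a
  unit     : ∀ {y a} → Pos (+ 3 * y - + 10 * a) (+ 3 * a - y) → Pos y a

Neg : ℤ → ℤ → Set
Neg y a = Pos (- y) (- a)

Pos-resp : ∀ {y a y′ a′} → Pos y a → y ≡ y′ → a ≡ a′ → Pos y′ a′
Pos-resp p refl refl = p

unit-quadrant : ∀ {y a} → 0ℤ < y → a ≤ 0ℤ →
                0ℤ < + 3 * y - + 10 * a × + 3 * a - y ≤ 0ℤ
unit-quadrant {y} {a} p q =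
    by< (3 ⊛ <⇒diff p ⊕ 10 ⊛ ≤⇒diff q ⊕ nonNeg 2) (solve (y ∷ a ∷ []))
  , by≤ (<⇒diff p ⊕ 3 ⊛ ≤⇒diff q ⊕ nonNeg 1) (solve (y ∷ a ∷ []))

unit⁻¹ : ∀ {y a} → Pos y a → Pos (+ 3 * y - + 10 * a) (+ 3 * a - y)
unit⁻¹ (quadrant p q) = let r , s = unit-quadrant p q in quadrant r s
unit⁻¹ (unit p) = p

unit-+ : ∀ y a y′ a′ →
  Pos (+ 3 * y - + 10 * a + (+ 3 * y′ - + 10 * a′)) (+ 3 * a - y + (+ 3 * a′ - y′)) →
  Pos (y + y′) (a + a′)
unit-+ y a y′ a′ p = unit (Pos-resp p
  (solve (y ∷ a ∷ y′ ∷ a′ ∷ [])) (solve (y ∷ a ∷ y′ ∷ a′ ∷ [])))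

-- The summands may need different numbers of `unit` steps. The quadrant is stable under the unit,
-- so the summand already there is carried along while the other one is still moving.
quadrant-+ : ∀ {y a y′ a′} → 0ℤ < y → a ≤ 0ℤ → Pos y′ a′ → Pos (y + y′) (a + a′)
quadrant-+ p q (quadrant p′ q′) = quadrant (ℤₚ.+-mono-< p p′) (ℤₚ.+-mono-≤ q q′)
quadrant-+ {y} {a} {y′} {a′} p q (unit r) =
  let p′ , q′ = unit-quadrant p q in unit-+ y a y′ a′ (quadrant-+ p′ q′ r)

Pos-+ : ∀ {y a y′ a′} → Pos y a → Pos y′ a′ → Pos (y + y′) (a + a′)
Pos-+ (quadrant p q) r = quadrant-+ p q r
Pos-+ {y} {a} {y′} {a′} (unit p) r = unit-+ y a y′ a′ (Pos-+ p (unit⁻¹ r))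

Pos-+* : ∀ {y a y′ a′ k} → Pos y a → 0ℤ ≤ k → Pos y′ a′ → Pos (y + k * y′) (a + k * a′)
Pos-+* {k = + zero} p _ q = Pos-resp p (sym (ℤₚ.+-identityʳ _)) (sym (ℤₚ.+-identityʳ _))
Pos-+* {y} {a} {y′} {a′} {+ suc n} p _ q = Pos-resp
  (Pos-+ (Pos-+* {k = + n} p (nonNeg n) q) q) (eq y y′ (+ n)) (eq a a′ (+ n))
  where
  eq : ∀ x x′ k → x + k * x′ + x′ ≡ x + (+ 1 + k) * x′
  eq x x′ k = solve (x ∷ x′ ∷ k ∷ [])

-- Most sign contradictions below end here: positive elements are added with nonnegative
-- multiplicities until both coordinates cancel.
¬Pos-0 : ∀ {y a} → Pos y a → y ≡ 0ℤ → a ≡ 0ℤ → ⊥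
¬Pos-0 (quadrant p _) refl _ = ℤₚ.<-irrefl refl p
¬Pos-0 (unit p) refl refl = ¬Pos-0 p refl refl

Pos-asym : ∀ {y a} → Pos y a → Neg y a → ⊥
Pos-asym {y} {a} p q = ¬Pos-0 (Pos-+ p q) (ℤₚ.+-inverseʳ y) (ℤₚ.+-inverseʳ a)

Pos-ℤ : ∀ {y} → Pos y 0ℤ → 0ℤ < y
Pos-ℤ {y} p with <-≥-cases 0ℤ y
... | inj₁ q = q
... | inj₂ q with ℤₚ.<-cmp y 0ℤ
...   | tri< r _ _ = ⊥-elim (Pos-asym p (quadrant (ℤₚ.neg-mono-< r) ℤₚ.≤-refl))
...   | tri≈ _ r _ = ⊥-elim (¬Pos-0 p r refl)
...   | tri> _ _ r = r

quadrant′ : ∀ {y a} → 0ℤ ≤ y → a < 0ℤ → Pos y a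
quadrant′ {y} {a} p q = unit (quadrant
  (by< (3 ⊛ p ⊕ 10 ⊛ <⇒diff q ⊕ nonNeg 9) (solve (y ∷ a ∷ [])))
  (by≤ (p ⊕ 3 ⊛ <⇒diff q ⊕ nonNeg 3) (solve (y ∷ a ∷ []))))

-- For positive coordinates the sign of y - a√10 is that of its norm y² - 10a²; this ties `Pos` to
-- the squared comparisons that define the ceilings.
SignNorm : ℤ → ℤ → Set
SignNorm y a = (Pos y a × + 10 * (a * a) < y * y) ⊎ (Neg y a × y * y < + 10 * (a * a))

-- Division by the unit shrinks a and flips the sign of the norm y² − 10a².
sign-norm-fuel : ∀ n {y a} → 0ℤ < y → 0ℤ < a → a < + n → SignNorm y a
sign-norm-fuel zero y>0 a>0 a<n = ⊥-elim (ℤₚ.<-asym a>0 a<n)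
sign-norm-fuel (suc n) {y} {a} y>0 a>0 a<n =
  cases (<-≥-cases 0ℤ (+ 10 * a - + 3 * y)) (<-≥-cases 0ℤ (y - + 3 * a))
  where
  smaller : ∀ {y a m} → 0ℤ < + 10 * a - + 3 * y → 0ℤ < a → a < + 1 + m →
            + 3 * (y - + 3 * a) < + 3 * m
  smaller {y} {a} {m} p q r =
    by< (<⇒diff p ⊕ 3 ⊛ <⇒diff r ⊕ 2 ⊛ <⇒diff q ⊕ nonNeg 2) (solve (y ∷ a ∷ m ∷ []))

  flip : SignNorm (+ 10 * a - + 3 * y) (y - + 3 * a) → SignNorm y a
  flip (inj₁ (r , s)) = inj₂
    ( unit (Pos-resp r (solve (y ∷ a ∷ [])) (solve (y ∷ a ∷ [])))
    , by< (<⇒diff s) (solve (y ∷ a ∷ [])))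
  flip (inj₂ (r , s)) = inj₁
    ( unit (Pos-resp r (solve (y ∷ a ∷ [])) (solve (y ∷ a ∷ [])))
    , by< (<⇒diff s) (solve (y ∷ a ∷ [])))

  cases : 0ℤ < + 10 * a - + 3 * y ⊎ + 10 * a - + 3 * y ≤ 0ℤ →
          0ℤ < y - + 3 * a ⊎ y - + 3 * a ≤ 0ℤ → SignNorm y a
  cases (inj₂ p) _ = inj₁
    ( unit (quadrant′
        (by≤ (≤⇒diff p) (solve (y ∷ a ∷ [])))
        (ℤₚ.*-cancelˡ-<-nonNeg (+ 3)
          (by< (≤⇒diff p ⊕ <⇒diff a>0) (solve (y ∷ a ∷ [])))))
    , ℤₚ.*-cancelˡ-<-nonNeg (+ 9)
        (by< (≤⇒diff p ⊗ (3 ⊛ <⇒diff y>0 ⊕ 10 ⊛ <⇒diff a>0 ⊕ nonNeg 13)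
              ⊕ 10 ⊛ (<⇒diff a>0 ⊗ (<⇒diff a>0 ⊕ nonNeg 2)) ⊕ nonNeg 9)
             (solve (y ∷ a ∷ []))))
  cases (inj₁ p) (inj₂ q) = inj₂
    ( unit (quadrant
        (by< (<⇒diff p) (solve (y ∷ a ∷ [])))
        (by≤ (≤⇒diff q) (solve (y ∷ a ∷ []))))
    , by< (≤⇒diff q ⊗ (<⇒diff y>0 ⊕ 3 ⊛ <⇒diff a>0 ⊕ nonNeg 4)
           ⊕ <⇒diff a>0 ⊗ (<⇒diff a>0 ⊕ nonNeg 2))
          (solve (y ∷ a ∷ [])))
  cases (inj₁ p) (inj₁ q) =
    flip (sign-norm-fuel n p q (ℤₚ.*-cancelˡ-<-nonNeg (+ 3) (smaller {y} p a>0 a<n)))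

sign-norm : ∀ {y a} → 0ℤ < y → 0ℤ < a → SignNorm y a
sign-norm {a = + n} p q = sign-norm-fuel (suc n) p q (+<+ (ℕₚ.n<1+n n))

-- Only coordinates of equal nonzero sign are difficult, and there `sign-norm` decides. That the
-- third alternative is zero alone expresses the irrationality of √10.
Pos-cmp : ∀ y a → Pos y a ⊎ Neg y a ⊎ (y ≡ 0ℤ × a ≡ 0ℤ)
Pos-cmp y a with ℤₚ.<-cmp 0ℤ y | ℤₚ.<-cmp 0ℤ a
... | tri< p _ _ | tri< q _ _ with sign-norm p q
...   | inj₁ (r , _) = inj₁ r
...   | inj₂ (r , _) = inj₂ (inj₁ r)
Pos-cmp y a | tri< p _ _ | tri≈ _ refl _ = inj₁ (quadrant p ℤₚ.≤-refl)
Pos-cmp y a | tri< p _ _ | tri> _ _ q = inj₁ (quadrant p (ℤₚ.<⇒≤ q))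
Pos-cmp y a | tri≈ _ refl _ | tri< q _ _ = inj₂ (inj₁ (quadrant′ ℤₚ.≤-refl (ℤₚ.neg-mono-< q)))
Pos-cmp y a | tri≈ _ refl _ | tri≈ _ refl _ = inj₂ (inj₂ (refl , refl))
Pos-cmp y a | tri≈ _ refl _ | tri> _ _ q = inj₁ (quadrant′ ℤₚ.≤-refl q)
Pos-cmp y a | tri> _ _ p | tri< q _ _ = inj₂ (inj₁ (quadrant (ℤₚ.neg-mono-< p) (ℤₚ.neg-mono-≤ (ℤₚ.<⇒≤ q))))
Pos-cmp y a | tri> _ _ p | tri≈ _ refl _ = inj₂ (inj₁ (quadrant (ℤₚ.neg-mono-< p) ℤₚ.≤-refl))
Pos-cmp y a | tri> _ _ p | tri> _ _ q with sign-norm (ℤₚ.neg-mono-< p) (ℤₚ.neg-mono-< q)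
...   | inj₁ (r , _) = inj₂ (inj₁ r)
...   | inj₂ (r , _) = inj₁ (Pos-resp r (ℤₚ.neg-involutive y) (ℤₚ.neg-involutive a))

square<⇒Neg : ∀ {u a} → 0ℤ < a → u < 0ℤ ⊎ u * u < + 10 * (a * a) → Neg u a
square<⇒Neg {u} {a} a>0 (inj₁ p) = quadrant (ℤₚ.neg-mono-< p) (ℤₚ.neg-mono-≤ (ℤₚ.<⇒≤ a>0))
square<⇒Neg {u} {a} a>0 (inj₂ p) with <-≥-cases 0ℤ u
... | inj₂ q = quadrant′ (ℤₚ.neg-mono-≤ q) (ℤₚ.neg-mono-< a>0)
... | inj₁ q with sign-norm q a>0
...   | inj₁ (_ , r) = ⊥-elim (ℤₚ.<-asym p r)
...   | inj₂ (r , _) = r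

-- Equality of the squares is impossible for a > 0, because `sign-norm` offers only strict
-- alternatives; so the non-strict side of a ceiling becomes strict.
square≥⇒Pos : ∀ {u a} → 0ℤ < a → 0ℤ ≤ u → + 10 * (a * a) ≤ u * u → Pos u a
square≥⇒Pos {u} {a} a>0 u≥0 q with ℤₚ.<-cmp 0ℤ u
... | tri> _ _ r = ⊥-elim (ℤₚ.<⇒≱ r u≥0)
... | tri≈ _ r _ = ⊥-elim (u≢0 (subst (λ v → + 10 * (a * a) ≤ v * v) (sym r) q))
  where
  u≢0 : + 10 * (a * a) ≤ 0ℤ → ⊥
  u≢0 s = by⊥ (≤⇒diff s ⊕ 10 ⊛ (<⇒diff a>0 ⊗ (<⇒diff a>0 ⊕ nonNeg 2)) ⊕ nonNeg 9)
              (solve (a ∷ []))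
... | tri< r _ _ with sign-norm r a>0
...   | inj₁ (s , _) = s
...   | inj₂ (_ , s) = ⊥-elim (ℤₚ.<⇒≱ s q)

-- The lattice, its coset and windows free of hits

Lattice : ℤ → ℤ → Set
Lattice y a = ∃[ t ] y ≡ + 3 * t + + 2 * a

Coset : ℤ → ℤ → Set
Coset y a = ∃[ t ] y ≡ + 3 * t + + 2 * a + + 2

Coset-+ : ∀ {y a y′ a′} → Coset y a → Lattice y′ a′ → Coset (y + y′) (a + a′)
Coset-+ {a = a} {a′ = a′} (t , refl) (t′ , refl) = t + t′ , solve (t ∷ t′ ∷ a ∷ a′ ∷ [])

0≢3k+2 : ∀ k → 0ℤ ≡ + 3 * k + + 2 → ⊥
0≢3k+2 k eq with <-≥-cases k 0ℤ
... | inj₁ p = by⊥ (3 ⊛ <⇒diff p) (trans (helper k) (cong (λ u → - u - + 1) (sym eq)))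
  where
  helper : ∀ k → + 3 * (0ℤ - (+ 1 + k)) ≡ - (+ 3 * k + + 2) - + 1
  helper k = solve (k ∷ [])
... | inj₂ p = by⊥ (3 ⊛ ≤⇒diff p ⊕ nonNeg 1) (trans (helper k) (cong (λ u → u - + 1) (sym eq)))
  where
  helper : ∀ k → + 3 * (k - 0ℤ) + + 1 ≡ + 3 * k + + 2 - + 1
  helper k = solve (k ∷ [])

-- Zero lies outside the coset, since 0 is not congruent to 2 modulo 3.
Coset-sign : ∀ {y a} → Coset y a → Pos y a ⊎ Neg y a
Coset-sign {y} {a} (t , eq) with Pos-cmp y a
... | inj₁ p = inj₁ p
... | inj₂ (inj₁ p) = inj₂ p
... | inj₂ (inj₂ (refl , refl)) = ⊥-elim (0≢3k+2 t (trans eq (helper t)))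
  where
  helper : ∀ t → + 3 * t + + 2 * 0ℤ + + 2 ≡ + 3 * t + + 2
  helper t = solve (t ∷ [])

-- No coset point between −(w,d) and 0 has its height b·y + a·e in (i, i + n + 1].
NoHit : (b a w d i n : ℤ) → Set
NoHit b a w d i n = ∀ {y e} → Coset y e → Neg y e → Pos (y + w) (e + d) →
  i < b * y + a * e → b * y + a * e ≤ i + n + + 1 → ⊥

-- Gaps between hits of a one-sided best approximation

height-+ : ∀ b a y e y′ e′ → b * (y + y′) + a * (e + e′) ≡ b * y + a * e + (b * y′ + a * e′)
height-+ b a y e y′ e′ = solve (b ∷ a ∷ y ∷ e ∷ y′ ∷ e′ ∷ [])

height-* : ∀ b a k y e → b * (k * y) + a * (k * e) ≡ k * (b * y + a * e)
height-* b a k y e = solve (b ∷ a ∷ k ∷ y ∷ e ∷ [])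

combination-large : ∀ {x u r v} → 0ℤ ≤ r → 0ℤ ≤ v → 0ℤ < x → 0ℤ < u → r + v ≤ x * r + u * v
combination-large {x} {u} {r} {v} r≥0 v≥0 p q =
  by≤ (<⇒diff p ⊗ r≥0 ⊕ <⇒diff q ⊗ v≥0) (solve (x ∷ u ∷ r ∷ v ∷ []))

combination-nonPos : ∀ {x u r v} → 0ℤ ≤ r → 0ℤ ≤ v → x ≤ 0ℤ → u ≤ 0ℤ → x * r + u * v ≤ 0ℤ
combination-nonPos {x} {u} {r} {v} r≥0 v≥0 p q =
  by≤ (≤⇒diff p ⊗ r≥0 ⊕ ≤⇒diff q ⊗ v≥0) (solve (x ∷ u ∷ r ∷ v ∷ []))

-- If R > 0 > V, a combination xR + uV in (0, R) has x, u ≥ 1.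
no-mixed-above : ∀ {x u ry ra vy va} → Pos ry ra → Neg vy va → 0ℤ < x → u ≤ 0ℤ →
  Neg (x * ry + u * vy - ry) (x * ra + u * va - ra) → ⊥
no-mixed-above {x} {u} {ry} {ra} {vy} {va} R>0 V<0 p q D<R =
  ¬Pos-0 (Pos-+* (Pos-+* D<R (<⇒diff p) R>0) (≤⇒diff q) V<0) (eq x u ry vy) (eq x u ra va)
  where
  eq : ∀ x u r v → - (x * r + u * v - r) + (x - (+ 1 + 0ℤ)) * r + (0ℤ - u) * - v ≡ 0ℤ
  eq x u r v = solve (x ∷ u ∷ r ∷ v ∷ [])

no-mixed-below : ∀ {x u ry ra vy va} → Pos ry ra → Neg vy va → x ≤ 0ℤ → 0ℤ ≤ u →
  Pos (x * ry + u * vy) (x * ra + u * va) → ⊥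
no-mixed-below {x} {u} {ry} {ra} {vy} {va} R>0 V<0 p q D>0 =
  ¬Pos-0 (Pos-+* (Pos-+* D>0 (≤⇒diff p) R>0) q V<0) (eq x u ry vy) (eq x u ra va)
  where
  eq : ∀ x u r v → x * r + u * v + (0ℤ - x) * r + u * - v ≡ 0ℤ
  eq x u r v = solve (x ∷ u ∷ r ∷ v ∷ [])

Neg-+ : ∀ {y a y′ a′} → Neg y a → Neg y′ a′ → Neg (y + y′) (a + a′)
Neg-+ {y} {a} {y′} {a′} p q = Pos-resp (Pos-+ p q)
  (sym (ℤₚ.neg-distrib-+ y y′)) (sym (ℤₚ.neg-distrib-+ a a′))

Pos-shift : ∀ y e ry ra vy va → Pos (y + ry) (e + ra) → Pos (ry + vy) (ra + va) →
  Pos (y + vy + ry + ry) (e + va + ra + ra)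
Pos-shift y e ry ra vy va p q = Pos-resp (Pos-+ p q) (eq y ry vy) (eq e ra va)
  where
  eq : ∀ y r v → y + r + (r + v) ≡ y + v + r + r
  eq y r v = solve (y ∷ r ∷ v ∷ [])

shift-V : ∀ {h r v} → 0ℤ ≤ r → 0ℤ < v → h < h + v × h + v ≤ h + (r + v)
shift-V {h} {r} {v} r≥0 v>0 =
  by< (<⇒diff v>0) (solve (h ∷ v ∷ [])) , by≤ r≥0 (solve (h ∷ r ∷ v ∷ []))

shift-V+R : ∀ {h r v} → 0ℤ ≤ r → 0ℤ < v → h < h + v + r × h + v + r ≤ h + (r + v)
shift-V+R {h} {r} {v} r≥0 v>0 =
  by< (<⇒diff v>0 ⊕ r≥0) (solve (h ∷ r ∷ v ∷ [])) ,
  by≤ (nonNeg 0) (solve (h ∷ r ∷ v ∷ []))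

h≤1+i+g : ∀ {h i g} → h ≤ i + g → h ≤ + 1 + i + g
h≤1+i+g {h} {i} {g} p = by≤ (≤⇒diff p ⊕ nonNeg 1) (solve (h ∷ i ∷ g ∷ []))

1+[h+n]≡h+[1+n] : ∀ h n → + 1 + (h + n) ≡ h + (+ 1 + n)
1+[h+n]≡h+[1+n] h n = solve (h ∷ n ∷ [])

h+[i-h]≡i : ∀ h i → h + (i - h) ≡ i
h+[i-h]≡i h i = solve (h ∷ i ∷ [])

y+r+[w-r]≡y+w : ∀ y r w → y + r + (w - r) ≡ y + w
y+r+[w-r]≡y+w y r w = solve (y ∷ r ∷ w ∷ [])

module Record
  (ry ra vy va py pa : ℤ)
  (R∈L : Lattice ry ra) (V∈L : Lattice vy va) (P∈C : Coset py pa)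
  (R>0 : Pos ry ra) (V<0 : Neg vy va) (R+V>0 : Pos (ry + vy) (ra + va))
  (P<0 : Neg py pa) (P+R>0 : Pos (py + ry) (pa + ra))
  (b a : ℤ) (hR≥0 : 0ℤ ≤ b * ry + a * ra) (hV>0 : 0ℤ < b * vy + a * va)
  where

  hR hV hP : ℤ
  hR = b * ry + a * ra
  hV = b * vy + a * va
  hP = b * py + a * pa

  HitR : ℤ → ℤ → Set
  HitR y e = Coset y e × Neg y e × Pos (y + ry) (e + ra)

  -- R is a one-sided best approximation: no lattice point lower than R + V
  -- lies strictly between 0 and R.
  best : ∀ x u → Pos (x * ry + u * vy) (x * ra + u * va) →
    0ℤ < x * hR + u * hV → x * hR + u * hV < hR + hV →
    Neg (x * ry + u * vy - ry) (x * ra + u * va - ra) → ⊥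
  best x u D>0 hD>0 hD< D<R = cases (<-≥-cases 0ℤ x) (<-≥-cases 0ℤ u)
    where
    cases : 0ℤ < x ⊎ x ≤ 0ℤ → 0ℤ < u ⊎ u ≤ 0ℤ → ⊥
    cases (inj₁ p) (inj₁ q) = ℤₚ.<⇒≱ hD< (combination-large hR≥0 (ℤₚ.<⇒≤ hV>0) p q)
    cases (inj₁ p) (inj₂ q) = no-mixed-above R>0 V<0 p q D<R
    cases (inj₂ p) (inj₁ q) = no-mixed-below R>0 V<0 p (ℤₚ.<⇒≤ q) D>0
    cases (inj₂ p) (inj₂ q) = ℤₚ.<⇒≱ hD>0 (combination-nonPos hR≥0 (ℤₚ.<⇒≤ hV>0) p q)

  Next : ℤ → Set
  Next i = ∃[ y ] ∃[ e ] HitR y e × i < b * y + a * e × b * y + a * e ≤ i + (hR + hV)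

  -- A three-distance argument. P + V is negative, so it is the new hit if P + V + R > 0. Otherwise
  -- P + V + R is negative, and it is a hit because its translate by R is (P + R) + (R + V) > 0.
  next : ∀ {y e} → HitR y e → Next (b * y + a * e)
  next {y} {e} (c , P<0 , P+R>0) = cases (Coset-sign (Coset-+ (Coset-+ c V∈L) R∈L))
    where
    hV+ : b * (y + vy) + a * (e + va) ≡ b * y + a * e + hV
    hV+ = height-+ b a y e vy va

    hVR+ : b * (y + vy + ry) + a * (e + va + ra) ≡ b * y + a * e + hV + hR
    hVR+ = trans (height-+ b a (y + vy) (e + va) ry ra) (cong (_+ hR) hV+)

    cases : Pos (y + vy + ry) (e + va + ra) ⊎ Neg (y + vy + ry) (e + va + ra) →
            Next (b * y + a * e)
    cases (inj₁ p) = y + vy , e + va , (Coset-+ c V∈L , Neg-+ P<0 V<0 , p) ,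
      subst (λ h → b * y + a * e < h × h ≤ b * y + a * e + (hR + hV)) (sym hV+)
        (shift-V hR≥0 hV>0)
    cases (inj₂ p) = y + vy + ry , e + va + ra ,
      (Coset-+ (Coset-+ c V∈L) R∈L , p , Pos-shift y e ry ra vy va P+R>0 R+V>0) ,
      subst (λ h → b * y + a * e < h × h ≤ b * y + a * e + (hR + hV)) (sym hVR+)
        (shift-V+R hR≥0 hV>0)

  next-suc : ∀ {i} → Next i → Next (+ 1 + i)
  next-suc {i} (y , e , hit , p , q) = cases (ℤₚ.<-cmp (+ 1 + i) (b * y + a * e))
    where
    cases : Tri _ _ _ → Next (+ 1 + i)
    cases (tri< r _ _) = y , e , hit , r , h≤1+i+g {i = i} q
    cases (tri≈ _ r _) = subst Next (sym r) (next hit)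
    cases (tri> _ _ r) = ⊥-elim (ℤₚ.<⇒≱ r (ℤₚ.i<j⇒suc[i]≤j p))

  next-from : ∀ n → Next (hP + + n)
  next-from zero = subst Next (sym (ℤₚ.+-identityʳ _)) (next (P∈C , P<0 , P+R>0))
  next-from (suc n) = subst Next (1+[h+n]≡h+[1+n] hP (+ n)) (next-suc (next-from n))

  next-≥ : ∀ {i} → hP ≤ i → Next i
  next-≥ {i} p = subst Next
    (trans (cong (_+_ hP) (ℤₚ.0≤i⇒+∣i∣≡i (≤⇒diff p))) (h+[i-h]≡i hP i))
    (next-from ∣ i - hP ∣)

  -- Here x and u are the coordinates of D = (w, d) with respect to R and V. By `best`, f(D) ≥ f(R),
  -- so every hit for R is a hit for D and the window must miss it: either the window ends before P,
  -- or it starts at or after the height of P and is shorter than the largest gap between hits.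
  gap : ∀ w d {i n} x u → w ≡ x * ry + u * vy → d ≡ x * ra + u * va →
    Pos w d → 0ℤ < b * w + a * d → b * w + a * d < hR + hV →
    NoHit b a w d i n →
    (i < hP × i + n + + 1 < hP) ⊎
    (hP ≤ i × n + + 1 < hR + hV)
  gap _ _ {i} {n} x u refl refl D>0 hD>0 hD< noHit = cases (<-≥-cases i (hP))
    where
    hD : b * (x * ry + u * vy) + a * (x * ra + u * va) ≡ x * hR + u * hV
    hD = trans (height-+ b a (x * ry) (x * ra) (u * vy) (u * va))
               (cong₂ _+_ (height-* b a x ry ra) (height-* b a u vy va))

    R⇒D : ∀ y e → Pos (y + ry) (e + ra) → Pos (y + (x * ry + u * vy)) (e + (x * ra + u * va))
    R⇒D y e p with Pos-cmp (x * ry + u * vy - ry) (x * ra + u * va - ra)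
    ... | inj₁ q = Pos-resp (Pos-+ p q) (y+r+[w-r]≡y+w y ry _) (y+r+[w-r]≡y+w e ra _)
    ... | inj₂ (inj₁ q) = ⊥-elim (best x u D>0 (subst (0ℤ <_) hD hD>0) (subst (_< hR + hV) hD hD<) q)
    ... | inj₂ (inj₂ (q , q′)) = Pos-resp p
      (cong (_+_ y) (sym (ℤₚ.i-j≡0⇒i≡j _ _ q))) (cong (_+_ e) (sym (ℤₚ.i-j≡0⇒i≡j _ _ q′)))

    cases : i < hP ⊎ hP ≤ i → _
    cases (inj₁ p) = inj₁ (p , ℤₚ.≰⇒> (noHit P∈C P<0 (R⇒D py pa P+R>0) p))
    cases (inj₂ p) with next-≥ p
    ... | y , e , (c , N , Q) , r , s = inj₂ (p , ℤₚ.≰⇒> λ t → noHit c N (R⇒D y e Q) r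
      (ℤₚ.≤-trans s (subst (i + (hR + hV) ≤_)
        (sym (ℤₚ.+-assoc i n (+ 1))) (ℤₚ.+-monoʳ-≤ i t))))

-- The four approximations of one period

literal : ∀ {y a} {_ : True (0ℤ ℤₚ.<? y)} {_ : True (a ℤₚ.≤? 0ℤ)} → Pos y a
literal {_} {_} {p} {q} = quadrant (toWitness p) (toWitness q)

-- Since 2/3 > √10 − 5/2, only the second alternative is critical.
Bound : ℤ → ℤ → ℤ → Set
Bound i d n = + 2 * n ≤ + 3 * (i + d - + 1) ⊎
  (∃[ b ] ∃[ a ] 0ℤ ≤ b × 0ℤ < a × a * a ≤ + 10 * (b * b) + + 1 ×
     b * + 5 + a * + 1 ≤ i + d - + 1 × n + + 3 ≤ b * + 6 + a * + 2)

-- The levels in use form the orbits of (0, 1) and (1, 3) under `Level-step`, which preserves a² -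
-- 10b² (here 1 and -1). The bound on 2a is the one that R = (3, 0) requires.
record Level (b a : ℤ) : Set where
  constructor level
  field
    b≥0 : 0ℤ ≤ b
    a>0 : 0ℤ < a
    2a≤ : + 2 * a ≤ + 7 * b + + 6
    norm≤1 : a * a ≤ + 10 * (b * b) + + 1

-- (b, a) ↦ (19b + 6a, 60b + 19a) is composition of the height with M².
Level-step : ∀ {b a} → Level b a → Level (+ 19 * b + + 6 * a) (+ 60 * b + + 19 * a)
Level-step {b} {a} (level p q r s) = level
  (by≤ (19 ⊛ p ⊕ 6 ⊛ <⇒diff q ⊕ nonNeg 6) (solve (b ∷ a ∷ [])))
  (by< (60 ⊛ p ⊕ 19 ⊛ <⇒diff q ⊕ nonNeg 18) (solve (b ∷ a ∷ [])))
  (by≤ (13 ⊛ p ⊕ 4 ⊛ <⇒diff q ⊕ nonNeg 10) (solve (b ∷ a ∷ [])))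
  (by≤ (≤⇒diff s) (solve (b ∷ a ∷ [])))

Gap : (r v p i n : ℤ) → Set
Gap r v p i n = (i < p × i + n + + 1 < p) ⊎ (p ≤ i × n + + 1 < r + v)

-- `Gap` leaves n ≤ p - i - 2 or, with i ≥ p, n ≤ r + v - 2. The first numerical condition settles
-- the former, together with i ≥ 1; the second settles the latter.
two-thirds : ∀ r v p {i n d} → + 2 * p ≤ + 3 * r + + 6 → + 2 * v ≤ r + + 3 * p + + 1 →
  0ℤ < i → r ≤ d → Gap r v p i n → + 2 * n ≤ + 3 * (i + d - + 1)
two-thirds r v p {i} {n} {d} A _ i>0 r≤d (inj₁ (_ , q)) =
  by≤ (≤⇒diff A ⊕ 5 ⊛ <⇒diff i>0 ⊕ 3 ⊛ ≤⇒diff r≤d ⊕ 2 ⊛ <⇒diff q)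
      (solve (r ∷ p ∷ i ∷ n ∷ d ∷ []))
two-thirds r v p {i} {n} {d} _ B _ r≤d (inj₂ (p≤i , q)) =
  by≤ (≤⇒diff B ⊕ 3 ⊛ ≤⇒diff p≤i ⊕ 3 ⊛ ≤⇒diff r≤d ⊕ 2 ⊛ <⇒diff q)
      (solve (r ∷ v ∷ p ∷ i ∷ n ∷ d ∷ []))

-- The approximations R are (3, 0), (5, 1), (7, 2), (16, 5), where f is about 3, 1.84, 0.68, 0.19.
-- Each R + V is the next R, and the last one, (16, 5) + (41, 13) = (57, 18), is M²(3, 0). So the
-- four height ranges tile one period of renormalisation.
bound₁ : ∀ {b a t e i n} → Level b a → 0ℤ < i → Pos (+ 3 * t + + 2 * e) e →
  0ℤ < b * (+ 3 * t + + 2 * e) + a * e →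
  b * + 3 + a * + 0 ≤ b * (+ 3 * t + + 2 * e) + a * e →
  b * (+ 3 * t + + 2 * e) + a * e < b * + 3 + a * + 0 + (b * + 2 + a * + 1) →
  NoHit b a (+ 3 * t + + 2 * e) e i n → Bound i (b * (+ 3 * t + + 2 * e) + a * e) n
bound₁ {b} {a} {t} {e} (level b≥0 a>0 2a≤ _) i>0 D>0 hD>0 hD≥ hD< noHit = inj₁ (two-thirds
  (b * + 3 + a * + 0) (b * + 2 + a * + 1) (b * + 1 + a * + 1)
  (by≤ (≤⇒diff 2a≤) (solve (b ∷ a ∷ [])))
  (by≤ (2 ⊛ b≥0 ⊕ <⇒diff a>0 ⊕ nonNeg 2) (solve (b ∷ a ∷ [])))
  i>0 hD≥
  (Record.gap (+ 3) (+ 0) (+ 2) (+ 1) (+ 1) (+ 1)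
    (+ 1 , refl) (+ 0 , refl) (-[1+ 0 ] , refl)
    literal (unit literal) (unit literal) (unit literal) (unit literal)
    b a (by≤ (3 ⊛ b≥0) (solve (b ∷ a ∷ [])))
    (by< (2 ⊛ b≥0 ⊕ <⇒diff a>0) (solve (b ∷ a ∷ [])))
    (+ 3 * t + + 2 * e) e t e (solve (t ∷ e ∷ [])) (solve (t ∷ e ∷ [])) D>0 hD>0 hD< noHit))

-- For a window ending before P = (6, 2), the first condition of `two-thirds` would read a ≤ 3b + 6.
-- It fails at high levels, where a/b is close to √10; this is the source of the second alternative
-- of `Bound`.
bound₂ : ∀ {b a t e i n} → Level b a → 0ℤ < i → Pos (+ 3 * t + + 2 * e) e →
  0ℤ < b * (+ 3 * t + + 2 * e) + a * e →
  b * + 5 + a * + 1 ≤ b * (+ 3 * t + + 2 * e) + a * e →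
  b * (+ 3 * t + + 2 * e) + a * e < b * + 5 + a * + 1 + (b * + 2 + a * + 1) →
  NoHit b a (+ 3 * t + + 2 * e) e i n → Bound i (b * (+ 3 * t + + 2 * e) + a * e) n
bound₂ {b} {a} {t} {e} {i} {n} (level b≥0 a>0 _ norm) i>0 D>0 hD>0 hD≥ hD< noHit = cases hD≥
  (Record.gap (+ 5) (+ 1) (+ 2) (+ 1) (+ 6) (+ 2)
    (+ 1 , refl) (+ 0 , refl) (+ 0 , refl)
    (unit literal) (unit literal) (unit literal) (unit literal) (unit literal)
    b a (by≤ (5 ⊛ b≥0 ⊕ <⇒diff a>0 ⊕ nonNeg 1) (solve (b ∷ a ∷ [])))
    (by< (2 ⊛ b≥0 ⊕ <⇒diff a>0) (solve (b ∷ a ∷ [])))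
    (+ 3 * t + + 2 * e) e t (e - t) (solve (t ∷ e ∷ [])) (solve (t ∷ e ∷ [])) D>0 hD>0 hD< noHit)
  where
  cases : ∀ {d} → b * + 5 + a * + 1 ≤ d →
    Gap (b * + 5 + a * + 1) (b * + 2 + a * + 1) (b * + 6 + a * + 2) i n → Bound i d n
  cases {d} r≤d (inj₁ (_ , q)) = inj₂ (b , a , b≥0 , a>0 , norm ,
    by≤ (≤⇒diff r≤d ⊕ <⇒diff i>0) (solve (b ∷ a ∷ i ∷ d ∷ [])) ,
    by≤ (<⇒diff q ⊕ <⇒diff i>0) (solve (b ∷ a ∷ i ∷ n ∷ [])))
  cases {d} r≤d (inj₂ (p≤i , q)) = inj₁
    (by≤ (3 ⊛ ≤⇒diff p≤i ⊕ 3 ⊛ ≤⇒diff r≤d ⊕ 2 ⊛ <⇒diff q ⊕ 19 ⊛ b≥0 ⊕ 5 ⊛ <⇒diff a>0 ⊕ nonNeg 6)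
      (solve (b ∷ a ∷ i ∷ n ∷ d ∷ [])))

bound₃ : ∀ {b a t e i n} → Level b a → 0ℤ < i → Pos (+ 3 * t + + 2 * e) e →
  0ℤ < b * (+ 3 * t + + 2 * e) + a * e →
  b * + 7 + a * + 2 ≤ b * (+ 3 * t + + 2 * e) + a * e →
  b * (+ 3 * t + + 2 * e) + a * e < b * + 7 + a * + 2 + (b * + 9 + a * + 3) →
  NoHit b a (+ 3 * t + + 2 * e) e i n → Bound i (b * (+ 3 * t + + 2 * e) + a * e) n
bound₃ {b} {a} {t} {e} (level b≥0 a>0 _ _) i>0 D>0 hD>0 hD≥ hD< noHit = inj₁ (two-thirds
  (b * + 7 + a * + 2) (b * + 9 + a * + 3) (b * + 6 + a * + 2)
  (by≤ (9 ⊛ b≥0 ⊕ 2 ⊛ <⇒diff a>0 ⊕ nonNeg 8) (solve (b ∷ a ∷ [])))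
  (by≤ (7 ⊛ b≥0 ⊕ 2 ⊛ <⇒diff a>0 ⊕ nonNeg 3) (solve (b ∷ a ∷ [])))
  i>0 hD≥
  (Record.gap (+ 7) (+ 2) (+ 9) (+ 3) (+ 6) (+ 2)
    (+ 1 , refl) (+ 1 , refl) (+ 0 , refl)
    (unit literal) (unit literal) (unit (unit literal)) (unit literal) (unit (unit literal))
    b a (by≤ (7 ⊛ b≥0 ⊕ 2 ⊛ <⇒diff a>0 ⊕ nonNeg 2) (solve (b ∷ a ∷ [])))
    (by< (9 ⊛ b≥0 ⊕ 3 ⊛ <⇒diff a>0 ⊕ nonNeg 2) (solve (b ∷ a ∷ [])))
    (+ 3 * t + + 2 * e) e (+ 3 * t - e) (e - + 2 * t) (solve (t ∷ e ∷ [])) (solve (t ∷ e ∷ [])) D>0 hD>0 hD< noHit))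

-- The hypotheses concern the heights themselves rather than a `Level`, because the form y - 3e,
-- with (b, a) = (1, -3), also has to be covered.
bound₄ : ∀ {b a t e i n} → 0ℤ ≤ b * + 16 + a * + 5 → 0ℤ < b * + 41 + a * + 13 →
  0ℤ ≤ + 4 * b + a + + 6 → 0ℤ < i → Pos (+ 3 * t + + 2 * e) e →
  0ℤ < b * (+ 3 * t + + 2 * e) + a * e →
  b * + 16 + a * + 5 ≤ b * (+ 3 * t + + 2 * e) + a * e →
  b * (+ 3 * t + + 2 * e) + a * e < b * + 16 + a * + 5 + (b * + 41 + a * + 13) →
  NoHit b a (+ 3 * t + + 2 * e) e i n → Bound i (b * (+ 3 * t + + 2 * e) + a * e) n
bound₄ {b} {a} {t} {e} hR≥0 hV>0 4b+a≥ i>0 D>0 hD>0 hD≥ hD< noHit = inj₁ (two-thirds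
  (b * + 16 + a * + 5) (b * + 41 + a * + 13) (b * + 22 + a * + 7)
  (by≤ 4b+a≥ (solve (b ∷ a ∷ [])))
  (by≤ (nonNeg 1) (solve (b ∷ a ∷ [])))
  i>0 hD≥
  (Record.gap (+ 16) (+ 5) (+ 41) (+ 13) (+ 22) (+ 7)
    (+ 2 , refl) (+ 5 , refl) (+ 2 , refl)
    (unit (unit literal)) (unit (unit literal)) (unit (unit literal))
    (unit (unit literal)) (unit (unit literal))
    b a hR≥0 hV>0
    (+ 3 * t + + 2 * e) e (+ 13 * t - + 5 * e) (+ 2 * e - + 5 * t) (solve (t ∷ e ∷ [])) (solve (t ∷ e ∷ []))
    D>0 hD>0 hD< noHit))

-- Renormalisation and induction on the height

-- M²(y,e) = (19y + 60e, 6y + 19e) multiplies y − e√10 by (3 − √10)² > 0.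
Pos-M² : ∀ {y e} → Pos y e → Pos (+ 19 * y + + 60 * e) (+ 6 * y + + 19 * e)
Pos-M² {y} {e} p = unit (unit (Pos-resp p (solve (y ∷ e ∷ [])) (solve (y ∷ e ∷ []))))

Pos-M⁻² : ∀ {y e} → Pos y e → Pos (+ 19 * y - + 60 * e) (+ 19 * e - + 6 * y)
Pos-M⁻² {y} {e} p = Pos-resp (unit⁻¹ (unit⁻¹ p)) (solve (y ∷ e ∷ [])) (solve (y ∷ e ∷ []))

Coset-M² : ∀ {y e} → Coset y e → Coset (+ 19 * y + + 60 * e) (+ 6 * y + + 19 * e)
Coset-M² {e = e} (t , refl) = + 7 * t + + 12 * e + + 4 , solve (t ∷ e ∷ [])

-- M² carries a hit for M⁻²D to a hit for D. The new form is the old one composed with M², so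
-- heights and the window stay the same.
renormalise : ∀ b a w d {i n} → NoHit b a w d i n →
  NoHit (+ 19 * b + + 6 * a) (+ 60 * b + + 19 * a) (+ 19 * w - + 60 * d) (+ 19 * d - + 6 * w) i n
renormalise b a w d {i} {n} noHit {y} {e} c N P p q = noHit (Coset-M² c)
  (Pos-resp (Pos-M² N) (neg (+ 19) (+ 60) y e) (neg (+ 6) (+ 19) y e))
  (Pos-resp (Pos-M² P) (sumy y e w d) (sume y e w d))
  (subst (i <_) (hM b a y e) p) (subst (_≤ i + n + + 1) (hM b a y e) q)
  where
  neg : ∀ k l y e → k * (- y) + l * (- e) ≡ - (k * y + l * e)
  neg k l y e = solve (k ∷ l ∷ y ∷ e ∷ [])
  sumy : ∀ y e w d → + 19 * (y + (+ 19 * w - + 60 * d)) + + 60 * (e + (+ 19 * d - + 6 * w))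
    ≡ + 19 * y + + 60 * e + w
  sumy y e w d = solve (y ∷ e ∷ w ∷ d ∷ [])
  sume : ∀ y e w d → + 6 * (y + (+ 19 * w - + 60 * d)) + + 19 * (e + (+ 19 * d - + 6 * w))
    ≡ + 6 * y + + 19 * e + d
  sume y e w d = solve (y ∷ e ∷ w ∷ d ∷ [])
  hM : ∀ b a y e → (+ 19 * b + + 6 * a) * y + (+ 60 * b + + 19 * a) * e
    ≡ b * (+ 19 * y + + 60 * e) + a * (+ 6 * y + + 19 * e)
  hM b a y e = solve (b ∷ a ∷ y ∷ e ∷ [])

height-M⁻² : ∀ b a w d →
  (+ 19 * b + + 6 * a) * (+ 19 * w - + 60 * d) + (+ 60 * b + + 19 * a) * (+ 19 * d - + 6 * w)
  ≡ b * w + a * d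
height-M⁻² b a w d = solve (b ∷ a ∷ w ∷ d ∷ [])

Lattice-M⁻² : ∀ t e → + 19 * (+ 3 * t + + 2 * e) - + 60 * e
  ≡ + 3 * (+ 31 * t - + 12 * e) + + 2 * (+ 19 * e - + 6 * (+ 3 * t + + 2 * e))
Lattice-M⁻² t e = solve (t ∷ e ∷ [])

-- `k` is fuel. Renormalising keeps the height of D while b becomes 19b + 6a, so 3b grows by at
-- least 18 and the margin runs out.
Pos-bound : ℕ → Set
Pos-bound k = ∀ b a w d {i n} → Lattice w d → Level b a → 0ℤ < i → Pos w d → 0ℤ < b * w + a * d →
  b * + 3 + a * + 0 ≤ b * w + a * d → b * w + a * d < b * + 3 + + k →
  NoHit b a w d i n → Bound i (b * w + a * d) n

pos-bound : ∀ k → Pos-bound k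
pos-bound-next : ∀ k → Pos-bound k → ∀ b a w d {i n} → Lattice w d → Level b a → 0ℤ < i → Pos w d →
  0ℤ < b * w + a * d →
  b * + 16 + a * + 5 + (b * + 41 + a * + 13) ≤ b * w + a * d → b * w + a * d < b * + 3 + + suc k →
  NoHit b a w d i n → Bound i (b * w + a * d) n

pos-bound-next k IH b a w d {i} {n} (t , refl) lev@(level b≥0 a>0 _ _) i>0 D>0 hD>0 hD≥ hD< noHit =
  subst (λ h → Bound i h n) eq
    (IH (+ 19 * b + + 6 * a) (+ 60 * b + + 19 * a) _ _
      (+ 31 * t - + 12 * d , Lattice-M⁻² t d) (Level-step lev) i>0 (Pos-M⁻² D>0)
      (subst (0ℤ <_) (sym eq) hD>0)
      (subst (_ ≤_) (sym eq) (low hD≥))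
      (subst (_< _) (sym eq) (high {k = + k} hD<))
      (renormalise b a _ d {i} {n} noHit))
  where
  eq = height-M⁻² b a (+ 3 * t + + 2 * d) d
  low : ∀ {h} → b * + 16 + a * + 5 + (b * + 41 + a * + 13) ≤ h →
    (+ 19 * b + + 6 * a) * + 3 + (+ 60 * b + + 19 * a) * + 0 ≤ h
  low {h} p = by≤ (≤⇒diff p) (solve (b ∷ a ∷ h ∷ []))
  high : ∀ {h k} → h < b * + 3 + (+ 1 + k) → h < (+ 19 * b + + 6 * a) * + 3 + k
  high {h} {k} p = by< (<⇒diff p ⊕ 54 ⊛ b≥0 ⊕ 18 ⊛ <⇒diff a>0 ⊕ nonNeg 17) (solve (b ∷ a ∷ h ∷ k ∷ []))

pos-bound zero b a w d _ _ _ _ _ hD≥ hD< _ = ⊥-elim (contra hD≥ hD<)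
  where
  contra : ∀ {h} → b * + 3 + a * + 0 ≤ h → h < b * + 3 + 0ℤ → ⊥
  contra {h} p q = by⊥ (≤⇒diff p ⊕ <⇒diff q) (solve (b ∷ a ∷ h ∷ []))
pos-bound (suc k) b a w d {i} {n} (t , refl) lev i>0 D>0 hD>0 hD≥ hD< noHit =
  cases (<-≥-cases h (b * + 3 + a * + 0 + (b * + 2 + a * + 1)))
        (<-≥-cases h (b * + 5 + a * + 1 + (b * + 2 + a * + 1)))
        (<-≥-cases h (b * + 7 + a * + 2 + (b * + 9 + a * + 3)))
        (<-≥-cases h (b * + 16 + a * + 5 + (b * + 41 + a * + 13)))
  where
  open Level lev
  h = b * (+ 3 * t + + 2 * d) + a * d

  ≥₂ : ∀ {h} → b * + 3 + a * + 0 + (b * + 2 + a * + 1) ≤ h → b * + 5 + a * + 1 ≤ h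
  ≥₂ {h} p = by≤ (≤⇒diff p) (solve (b ∷ a ∷ h ∷ []))
  ≥₃ : ∀ {h} → b * + 5 + a * + 1 + (b * + 2 + a * + 1) ≤ h → b * + 7 + a * + 2 ≤ h
  ≥₃ {h} p = by≤ (≤⇒diff p) (solve (b ∷ a ∷ h ∷ []))
  ≥₄ : ∀ {h} → b * + 7 + a * + 2 + (b * + 9 + a * + 3) ≤ h → b * + 16 + a * + 5 ≤ h
  ≥₄ {h} p = by≤ (≤⇒diff p) (solve (b ∷ a ∷ h ∷ []))

  hR₄≥0 : 0ℤ ≤ b * + 16 + a * + 5
  hR₄≥0 = by≤ (16 ⊛ b≥0 ⊕ 5 ⊛ <⇒diff a>0 ⊕ nonNeg 5) (solve (b ∷ a ∷ []))
  hV₄>0 : 0ℤ < b * + 41 + a * + 13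
  hV₄>0 = by< (41 ⊛ b≥0 ⊕ 13 ⊛ <⇒diff a>0 ⊕ nonNeg 12) (solve (b ∷ a ∷ []))
  4b+a≥ : 0ℤ ≤ + 4 * b + a + + 6
  4b+a≥ = by≤ (4 ⊛ b≥0 ⊕ <⇒diff a>0 ⊕ nonNeg 7) (solve (b ∷ a ∷ []))

  cases : h < _ ⊎ _ → h < _ ⊎ _ → h < _ ⊎ _ → h < _ ⊎ _ → Bound i h n
  cases (inj₁ p) _ _ _ = bound₁ {b} {a} {t} {d} {i} {n} lev i>0 D>0 hD>0 hD≥ p noHit
  cases (inj₂ q) (inj₁ p) _ _ = bound₂ {b} {a} {t} {d} {i} {n} lev i>0 D>0 hD>0 (≥₂ q) p noHit
  cases _ (inj₂ q) (inj₁ p) _ = bound₃ {b} {a} {t} {d} {i} {n} lev i>0 D>0 hD>0 (≥₃ q) p noHit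
  cases _ _ (inj₂ q) (inj₁ p) =
    bound₄ {b} {a} {t} {d} {i} {n} hR₄≥0 hV₄>0 4b+a≥ i>0 D>0 hD>0 (≥₄ q) p noHit
  cases _ _ _ (inj₂ q) =
    pos-bound-next k (pos-bound k) b a _ d {i} {n} (t , refl) lev i>0 D>0 hD>0 q hD< noHit

-- Displacements of either sign, measured by the height e

diff-positive : ∀ {y y′ a} → Pos y a → Neg y′ a → 0ℤ < y - y′
diff-positive {y} {y′} {a} p q = Pos-ℤ (Pos-resp (Pos-+ p q) refl (ℤₚ.+-inverseʳ a))

height₀ : ∀ w d → + 0 * w + + 1 * d ≡ d
height₀ w d = solve (w ∷ d ∷ [])

<1+∣i∣ : ∀ i → i < + suc ∣ i ∣
<1+∣i∣ (+ n) = +<+ (ℕₚ.n<1+n n)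
<1+∣i∣ -[1+ n ] = -<+

bound⁺ : ∀ w d {i n} → Lattice w d → 0ℤ < d → 0ℤ < i → Pos w d →
  NoHit (+ 0) (+ 1) w d i n → Bound i d n
bound⁺ w d {i} {n} D∈L d>0 i>0 D>0 noHit = subst (λ h → Bound i h n) (height₀ w d)
  (pos-bound (suc ∣ d ∣) (+ 0) (+ 1) w d D∈L
    (level (nonNeg 0) (+<+ (ℕ.s≤s ℕ.z≤n)) (+≤+ (ℕ.s≤s (ℕ.s≤s ℕ.z≤n))) (+≤+ (ℕ.s≤s ℕ.z≤n)))
    i>0 D>0
    (subst (0ℤ <_) (sym (height₀ w d)) d>0)
    (subst (0ℤ ≤_) (sym (height₀ w d)) (ℤₚ.<⇒≤ d>0))
    (subst (_< + suc ∣ d ∣) (sym (height₀ w d)) (<1+∣i∣ d)) noHit)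

NoHit⁻ : (w d i n : ℤ) → Set
NoHit⁻ w d i n = ∀ {y e} → Coset y e → Pos y e → Neg (y + w) (e + d) →
  i < e → e ≤ i + n + + 1 → ⊥

-- M(y,e) = (3y + 10e, y + 3e) multiplies y − e√10 by 3 − √10 < 0; the height e
-- becomes y − 3e.
flip-sign : ∀ w d {i n} → NoHit⁻ w d i n →
  NoHit (+ 1) (- (+ 3)) (+ 3 * w + + 10 * d) (w + + 3 * d) i n
flip-sign w d {i} {n} noHit {y} {e} (t , eq) N P p q =
  noHit {+ 10 * e - + 3 * y} {y - + 3 * e}
    (+ 2 * e - + 5 * t - + 4 , trans (cong (λ y → + 10 * e - + 3 * y) eq)
      (trans (coset t e) (cong (λ y → + 3 * (+ 2 * e - + 5 * t - + 4) + + 2 * (y - + 3 * e) + + 2) (sym eq))))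
    (Pos-resp (unit⁻¹ N) (eq₁ y e) (eq₂ y e))
    (Pos-resp (unit⁻¹ P) (eq₃ y e w d) (eq₄ y e w d))
    (subst (i <_) (eq₅ y e) p) (subst (_≤ i + n + + 1) (eq₅ y e) q)
  where
  coset : ∀ t e → + 10 * e - + 3 * (+ 3 * t + + 2 * e + + 2)
    ≡ + 3 * (+ 2 * e - + 5 * t - + 4) + + 2 * (+ 3 * t + + 2 * e + + 2 - + 3 * e) + + 2
  coset t e = solve (t ∷ e ∷ [])
  eq₁ : ∀ y e → + 3 * (- y) - + 10 * (- e) ≡ + 10 * e - + 3 * y
  eq₁ y e = solve (y ∷ e ∷ [])
  eq₂ : ∀ y e → + 3 * (- e) - (- y) ≡ y - + 3 * e
  eq₂ y e = solve (y ∷ e ∷ [])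
  eq₃ : ∀ y e w d → + 3 * (y + (+ 3 * w + + 10 * d)) - + 10 * (e + (w + + 3 * d))
    ≡ - (+ 10 * e - + 3 * y + w)
  eq₃ y e w d = solve (y ∷ e ∷ w ∷ d ∷ [])
  eq₄ : ∀ y e w d → + 3 * (e + (w + + 3 * d)) - (y + (+ 3 * w + + 10 * d))
    ≡ - (y - + 3 * e + d)
  eq₄ y e w d = solve (y ∷ e ∷ w ∷ d ∷ [])
  eq₅ : ∀ y e → + 1 * y + - (+ 3) * e ≡ y - + 3 * e
  eq₅ y e = solve (y ∷ e ∷ [])

-- For the form y - 3e the points (16, 5) and (41, 13) have heights 1 and 2, so `bound₄` covers d <
-- 3. From d = 3 on, one renormalisation turns (1, -3) into the level (1, 3), where `pos-bound`
-- applies.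
bound⁻ : ∀ w d {i n} → Lattice w d → 0ℤ < d → 0ℤ < i → Neg w d →
  NoHit⁻ w d i n → Bound i d n
bound⁻ w d {i} {n} (t , refl) d>0 i>0 D<0 noHit⁻ = cases (<-≥-cases d (+ 3))
  where
  t′ e′ : ℤ
  t′ = t + + 2 * d
  e′ = + 3 * t + + 2 * d + + 3 * d

  M-lattice : ∀ t d → + 3 * (+ 3 * t + + 2 * d) + + 10 * d
    ≡ + 3 * (t + + 2 * d) + + 2 * (+ 3 * t + + 2 * d + + 3 * d)
  M-lattice t d = solve (t ∷ d ∷ [])

  M-height : ∀ t d → + 1 * (+ 3 * (t + + 2 * d) + + 2 * (+ 3 * t + + 2 * d + + 3 * d))
    + - (+ 3) * (+ 3 * t + + 2 * d + + 3 * d) ≡ d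
  M-height t d = solve (t ∷ d ∷ [])

  noHit : NoHit (+ 1) (- (+ 3)) (+ 3 * t′ + + 2 * e′) e′ i n
  noHit = subst (λ v → NoHit (+ 1) (- (+ 3)) v e′ i n) (M-lattice t d)
    (flip-sign (+ 3 * t + + 2 * d) d {i} {n} noHit⁻)

  MD>0 : Pos (+ 3 * t′ + + 2 * e′) e′
  MD>0 = unit (Pos-resp D<0 (eq₁ t d) (eq₂ t d))
    where
    eq₁ : ∀ t d → - (+ 3 * t + + 2 * d)
      ≡ + 3 * (+ 3 * (t + + 2 * d) + + 2 * (+ 3 * t + + 2 * d + + 3 * d)) - + 10 * (+ 3 * t + + 2 * d + + 3 * d)
    eq₁ t d = solve (t ∷ d ∷ [])
    eq₂ : ∀ t d → - d
      ≡ + 3 * (+ 3 * t + + 2 * d + + 3 * d) - (+ 3 * (t + + 2 * d) + + 2 * (+ 3 * t + + 2 * d + + 3 * d))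
    eq₂ t d = solve (t ∷ d ∷ [])

  eq₁ = M-height t d
  eq₂ = trans (height-M⁻² (+ 1) (- (+ 3)) (+ 3 * t′ + + 2 * e′) e′) eq₁

  cases : d < + 3 ⊎ + 3 ≤ d → Bound i d n
  cases (inj₁ p) = subst (λ h → Bound i h n) eq₁
    (bound₄ {+ 1} { - (+ 3)} {t′} {e′} {i} {n} (nonNeg 1) (+<+ (ℕ.s≤s ℕ.z≤n)) (nonNeg 7) i>0 MD>0
      (subst (0ℤ <_) (sym eq₁) d>0)
      (subst (+ 1 ≤_) (sym eq₁) (ℤₚ.i<j⇒suc[i]≤j d>0))
      (subst (_< + 3) (sym eq₁) p) noHit)
  cases (inj₂ p) = subst (λ h → Bound i h n) eq₂
    (pos-bound (suc ∣ d ∣) (+ 1) (+ 3)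
      (+ 19 * (+ 3 * t′ + + 2 * e′) - + 60 * e′) (+ 19 * e′ - + 6 * (+ 3 * t′ + + 2 * e′)) {i} {n}
      (+ 31 * t′ - + 12 * e′ , Lattice-M⁻² t′ e′)
      (level (nonNeg 1) (+<+ (ℕ.s≤s ℕ.z≤n))
        (toWitness {a? = + 6 ℤₚ.≤? + 13} _) (toWitness {a? = + 9 ℤₚ.≤? + 11} _))
      i>0 (Pos-M⁻² MD>0)
      (subst (0ℤ <_) (sym eq₂) d>0)
      (subst (+ 3 ≤_) (sym eq₂) p)
      (subst (_< + 3 + + suc ∣ d ∣) (sym eq₂) (ℤₚ.<-≤-trans (<1+∣i∣ d) (ℤₚ.i≤j+i _ (+ 3))))
      (renormalise (+ 1) (- (+ 3)) (+ 3 * t′ + + 2 * e′) e′ {i} {n} noHit))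

-- Comparing ratios with √10 - 5/2

-- p/q < √10 − 3/2, written for s = p − q as 2s + 5q < 2q√10.
Below : ℤ → ℤ → Set
Below s q = + 2 * s + + 5 * q < 0ℤ ⊎
  (+ 2 * s + + 5 * q) * (+ 2 * s + + 5 * q) < + 10 * ((+ 2 * q) * (+ 2 * q))

-- This is 2/3 > √10 - 5/2: at s/q = 2/3 the square of 2s/q + 5 is 361/9, just above 40.
below-two-thirds : ∀ {s q} → 0ℤ < q → Below s q → + 3 * s < + 2 * q
below-two-thirds {s} {q} q>0 (inj₁ p) = ℤₚ.*-cancelˡ-<-nonNeg (+ 2)
  (by< (3 ⊛ <⇒diff p ⊕ 19 ⊛ <⇒diff q>0 ⊕ nonNeg 21) (solve (s ∷ q ∷ [])))
below-two-thirds {s} {q} q>0 (inj₂ p) = ℤₚ.≰⇒> contra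
  where
  contra : + 2 * q ≤ + 3 * s → ⊥
  contra r = by⊥
    (9 ⊛ <⇒diff p ⊕ 2 ⊛ ≤⇒diff r ⊗ (2 ⊛ ≤⇒diff r ⊕ 38 ⊛ <⇒diff q>0 ⊕ nonNeg 38)
     ⊕ <⇒diff q>0 ⊗ (<⇒diff q>0 ⊕ nonNeg 2) ⊕ nonNeg 9)
    (solve (s ∷ q ∷ []))

ratio-nonNeg : ∀ {s q X Y} → 0ℤ < q → 0ℤ < X → 0ℤ ≤ Y → q * Y ≤ s * X → 0ℤ ≤ s
ratio-nonNeg {s} {q} {X} {Y} q>0 X>0 Y≥0 r = ℤₚ.≮⇒≥ neg
  where
  neg : s < 0ℤ → ⊥
  neg s<0 = by⊥
    (≤⇒diff r ⊕ <⇒diff s<0 ⊗ (<⇒diff X>0 ⊕ nonNeg 1) ⊕ (<⇒diff q>0 ⊕ nonNeg 1) ⊗ Y≥0 ⊕ <⇒diff X>0)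
    (solve (s ∷ q ∷ X ∷ Y ∷ []))

-- The quadratic form 4Y² + 20XY − 15X² vanishes on Y = (√10 − 5/2) X.
ratio-square : ∀ {s q X Y} → 0ℤ < q → 0ℤ < X → 0ℤ ≤ Y →
  0ℤ ≤ + 4 * (Y * Y) + + 20 * (X * Y) - + 15 * (X * X) →
  (+ 2 * s + + 5 * q) * (+ 2 * s + + 5 * q) < + 10 * ((+ 2 * q) * (+ 2 * q)) →
  q * Y ≤ s * X → ⊥
ratio-square {s} {q} {X} {Y} q>0 X>0 Y≥0 form p r = by⊥
  (<⇒diff p ⊗ square≥0 X ⊕ <⇒diff X>0 ⊗ (<⇒diff X>0 ⊕ nonNeg 2)
   ⊕ square≥0 q ⊗ form
   ⊕ 4 ⊛ (≤⇒diff r ⊗ (≤⇒diff r ⊕ (<⇒diff q>0 ⊕ nonNeg 1) ⊗ (2 ⊛ Y≥0 ⊕ 5 ⊛ <⇒diff X>0 ⊕ nonNeg 5))))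
  (solve (s ∷ q ∷ X ∷ Y ∷ []))

ratio-below : ∀ {s q X Y} → 0ℤ < q → 0ℤ < X → 0ℤ ≤ Y →
  0ℤ ≤ + 4 * (Y * Y) + + 20 * (X * Y) - + 15 * (X * X) → Below s q → s * X < q * Y
ratio-below {s} {q} {X} {Y} q>0 X>0 Y≥0 form (inj₁ p) = ℤₚ.≰⇒> λ r →
  contra (ratio-nonNeg {s} {q} {X} {Y} q>0 X>0 Y≥0 r)
  where
  contra : 0ℤ ≤ s → ⊥
  contra s≥0 = by⊥ (<⇒diff p ⊕ 2 ⊛ s≥0 ⊕ 5 ⊛ <⇒diff q>0 ⊕ nonNeg 5) (solve (s ∷ q ∷ []))
ratio-below {s} {q} {X} {Y} q>0 X>0 Y≥0 form (inj₂ p) = ℤₚ.≰⇒> (ratio-square {s} {q} {X} {Y} q>0 X>0 Y≥0 form p)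

Bound⇒ratio : ∀ {i d n s q} → 0ℤ < n → 0ℤ < i → 0ℤ < d → 0ℤ < q → Below s q → Bound i d n →
  s * n < q * (i + d - + 1)
Bound⇒ratio {i} {d} {n} {s} {q} n>0 i>0 d>0 q>0 below (inj₁ p) =
  strict (below-two-thirds q>0 below) p
  where
  strict : ∀ {K} → + 3 * s < + 2 * q → + 2 * n ≤ + 3 * K → s * n < q * K
  strict {K} p r = ℤₚ.*-cancelˡ-<-nonNeg (+ 3)
    (by< ((<⇒diff q>0 ⊕ nonNeg 1) ⊗ ≤⇒diff r ⊕ <⇒diff p ⊗ (<⇒diff n>0 ⊕ nonNeg 1) ⊕ <⇒diff n>0)
      (solve (s ∷ q ∷ n ∷ K ∷ [])))
Bound⇒ratio {i} {d} {n} {s} {q} n>0 i>0 d>0 q>0 below (inj₂ (b , a , b≥0 , a>0 , norm , p , r)) =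
  cases (<-≥-cases 0ℤ s) p
  where
  X>0 : 0ℤ < b * + 6 + a * + 2 - + 3
  X>0 = by< (≤⇒diff r ⊕ <⇒diff n>0) (solve (b ∷ a ∷ n ∷ []))
  Y≥0 : 0ℤ ≤ b * + 5 + a * + 1
  Y≥0 = by≤ (5 ⊛ b≥0 ⊕ <⇒diff a>0 ⊕ nonNeg 1) (solve (b ∷ a ∷ []))

  -- At X = 6b + 2a, Y = 5b + a the form of `ratio-square` is 16(10b² - a²), hence at least -16.
  -- Lowering X by 3 adds 240b + 120a - 135, and X > 0 makes the total nonnegative.
  form : ∀ {b a} → 0ℤ < a → a * a ≤ + 10 * (b * b) + + 1 → 0ℤ < b * + 6 + a * + 2 - + 3 →
    0ℤ ≤ + 4 * ((b * + 5 + a * + 1) * (b * + 5 + a * + 1))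
       + + 20 * ((b * + 6 + a * + 2 - + 3) * (b * + 5 + a * + 1))
       - + 15 * ((b * + 6 + a * + 2 - + 3) * (b * + 6 + a * + 2 - + 3))
  form {b} {a} a>0 norm X>0 =
    by≤ (16 ⊛ ≤⇒diff norm ⊕ 40 ⊛ <⇒diff X>0 ⊕ 40 ⊛ <⇒diff a>0 ⊕ nonNeg 49) (solve (b ∷ a ∷ []))

  nonPos : ∀ {K} → s ≤ 0ℤ → 0ℤ < K → s * n < q * K
  nonPos {K} s≤0 K>0 =
    by< (≤⇒diff s≤0 ⊗ (<⇒diff n>0 ⊕ nonNeg 1) ⊕ <⇒diff q>0 ⊗ (<⇒diff K>0 ⊕ nonNeg 1) ⊕ <⇒diff K>0)
      (solve (s ∷ q ∷ n ∷ K ∷ []))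

  positive : ∀ {K X Y} → 0ℤ < s → s * X < q * Y → n + + 3 ≤ X + + 3 → Y ≤ K → s * n < q * K
  positive {K} {X} {Y} s>0 sX<qY n≤X Y≤K =
    by< (<⇒diff sX<qY ⊕ (<⇒diff s>0 ⊕ nonNeg 1) ⊗ ≤⇒diff n≤X ⊕ (<⇒diff q>0 ⊕ nonNeg 1) ⊗ ≤⇒diff Y≤K)
      (solve (s ∷ q ∷ n ∷ K ∷ X ∷ Y ∷ []))

  X+3 : ∀ b a → b * + 6 + a * + 2 ≡ b * + 6 + a * + 2 - + 3 + + 3
  X+3 b a = solve (b ∷ a ∷ [])

  K>0 : 0ℤ < i + d - + 1
  K>0 = by< (<⇒diff i>0 ⊕ <⇒diff d>0) (solve (i ∷ d ∷ []))

  cases : 0ℤ < s ⊎ s ≤ 0ℤ → b * + 5 + a * + 1 ≤ i + d - + 1 → s * n < q * (i + d - + 1)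
  cases (inj₂ s≤0) p = nonPos s≤0 K>0
  cases (inj₁ s>0) p = positive {X = b * + 6 + a * + 2 - + 3} {b * + 5 + a * + 1} s>0
    (ratio-below {s} {q} {b * + 6 + a * + 2 - + 3} {b * + 5 + a * + 1} q>0 X>0 Y≥0 (form {b} {a} a>0 norm X>0) below)
    (subst (n + + 3 ≤_) (X+3 b a) r) p

-- Along the critical family the form is only linear in X, while its value would
-- have to be at least (X/q)².
ratio-above : ∀ {s q X Y} → 0ℤ < q → 0ℤ ≤ Y →
  0ℤ ≤ + 2 * s + + 5 * q →
  + 10 * ((+ 2 * q) * (+ 2 * q)) < (+ 2 * s + + 5 * q) * (+ 2 * s + + 5 * q) →
  + 4 * (Y * Y) + + 20 * (X * Y) - + 15 * (X * X) ≤ + 121 * X →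
  + 121 * (q * q) < X → q * Y < s * X
ratio-above {s} {q} {X} {Y} q>0 Y≥0 p p′ form large = ℤₚ.≰⇒> contra
  where
  s>0 : 0ℤ < s
  s>0 = ℤₚ.≰⇒> nonPos
    where
    nonPos : s ≤ 0ℤ → ⊥
    nonPos s≤0 = by⊥
     (<⇒diff p′ ⊕ 2 ⊛ ≤⇒diff s≤0 ⊗ (p ⊕ 5 ⊛ <⇒diff q>0 ⊕ nonNeg 5) ⊕ 15 ⊛ square≥0 q)
     (solve (s ∷ q ∷ []))
  X>0 : 0ℤ < X
  X>0 = by< (<⇒diff large ⊕ 121 ⊛ square≥0 q) (solve (q ∷ X ∷ []))
  contra : s * X ≤ q * Y → ⊥
  contra r = by⊥
    (square≥0 q ⊗ ≤⇒diff form
     ⊕ 4 ⊛ (≤⇒diff r ⊗ ((<⇒diff q>0 ⊕ nonNeg 1) ⊗ Y≥0 ⊕ (<⇒diff s>0 ⊕ nonNeg 1) ⊗ (<⇒diff X>0 ⊕ nonNeg 1)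
          ⊕ 5 ⊛ ((<⇒diff q>0 ⊕ nonNeg 1) ⊗ (<⇒diff X>0 ⊕ nonNeg 1))))
     ⊕ square≥0 X ⊗ <⇒diff p′ ⊕ (<⇒diff X>0 ⊕ nonNeg 1) ⊗ <⇒diff large ⊕ <⇒diff X>0)
    (solve (s ∷ q ∷ X ∷ Y ∷ []))

-- The critical family

no-mixed-outside : ∀ {x u ry ra vy va py pa} → Pos ry ra → Neg vy va → Pos (py - vy) (pa - va) →
  0ℤ ≤ x → u < 0ℤ → Neg (py + (x * ry + u * vy)) (pa + (x * ra + u * va)) → ⊥
no-mixed-outside {x} {u} {ry} {ra} {vy} {va} {py} {pa} R>0 V<0 P>V x≥0 u<0 N =
  ¬Pos-0 (Pos-+ (Pos-+* (Pos-+* N x≥0 R>0) (<⇒diff u<0) V<0) P>V)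
    (eq x u ry vy py) (eq x u ra va pa)
  where
  eq : ∀ x u r v p → - (p + (x * r + u * v)) + x * r + (0ℤ - (+ 1 + u)) * (- v) + (p - v) ≡ 0ℤ
  eq x u r v p = solve (x ∷ u ∷ r ∷ v ∷ p ∷ [])

no-mixed-inside : ∀ {x u ry ra vy va py pa} → Pos ry ra → Neg vy va → Neg py pa →
  x < 0ℤ → 0ℤ ≤ u →
  Pos (py + (x * ry + u * vy) + ry) (pa + (x * ra + u * va) + ra) → ⊥
no-mixed-inside {x} {u} {ry} {ra} {vy} {va} {py} {pa} R>0 V<0 P<0 x<0 u≥0 Q =
  ¬Pos-0 (Pos-+ (Pos-+* (Pos-+* Q (<⇒diff x<0) R>0) u≥0 V<0) P<0)
    (eq x u ry vy py) (eq x u ra va pa)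
  where
  eq : ∀ x u r v p → p + (x * r + u * v) + r + (0ℤ - (+ 1 + x)) * r + u * (- v) + - p ≡ 0ℤ
  eq x u r v p = solve (x ∷ u ∷ r ∷ v ∷ p ∷ [])

critical-coordinate : ∀ z e → + 3 * z + + 2 * e + + 2 ≡ + 6 + (z * + 5 + (e - + 2 - z) * + 2)
critical-coordinate z e = solve (z ∷ e ∷ [])

critical-index : ∀ z e → e ≡ + 2 + (z * + 1 + (e - + 2 - z) * + 1)
critical-index z e = solve (z ∷ e ∷ [])

critical-height : ∀ b a z e → b * (+ 3 * z + + 2 * e + + 2) + a * e
  ≡ b * + 6 + a * + 2 + (z * (b * + 5 + a * + 1) + (e - + 2 - z) * (b * + 2 + a * + 1))
critical-height b a z e = solve (b ∷ a ∷ z ∷ e ∷ [])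

combination-high : ∀ {x u h r v} → 0ℤ ≤ r → 0ℤ ≤ v → 0ℤ ≤ x → 0ℤ ≤ u → h ≤ h + (x * r + u * v)
combination-high {x} {u} {h} {r} {v} p q s t = by≤ (s ⊗ p ⊕ t ⊗ q)
  (solve (x ∷ u ∷ h ∷ r ∷ v ∷ []))

combination-low : ∀ {x u h r v} → 0ℤ ≤ r → 0ℤ ≤ v → x < 0ℤ → u < 0ℤ → h ≤ r + v →
  h + (x * r + u * v) ≤ 0ℤ
combination-low {x} {u} {h} {r} {v} p q s t l = by≤ (<⇒diff s ⊗ p ⊕ <⇒diff t ⊗ q ⊕ ≤⇒diff l)
  (solve (x ∷ u ∷ h ∷ r ∷ v ∷ []))

5b+a≥0 : ∀ {b a} → 0ℤ ≤ b → 0ℤ < a → 0ℤ ≤ b * + 5 + a * + 1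
5b+a≥0 {b} {a} b≥0 a>0 = by≤ (5 ⊛ b≥0 ⊕ <⇒diff a>0 ⊕ nonNeg 1) (solve (b ∷ a ∷ []))

2b+a≥0 : ∀ {b a} → 0ℤ ≤ b → 0ℤ < a → 0ℤ ≤ b * + 2 + a * + 1
2b+a≥0 {b} {a} b≥0 a>0 = by≤ (2 ⊛ b≥0 ⊕ <⇒diff a>0 ⊕ nonNeg 1) (solve (b ∷ a ∷ []))

6b+2a≤7b+2a : ∀ {b} a → 0ℤ ≤ b → b * + 6 + a * + 2 ≤ b * + 5 + a * + 1 + (b * + 2 + a * + 1)
6b+2a≤7b+2a {b} a b≥0 = by≤ b≥0 (solve (b ∷ a ∷ []))

below-critical : ∀ {n h H} → n + + 3 ≡ H → h ≤ + 1 + n + + 1 → h < H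
below-critical {n} {h} refl p = by< (≤⇒diff p) (solve (n ∷ h ∷ []))

-- (5, 1) and (2, 1) form a basis of L, so a coset point is (6, 2) + z(5, 1) + u(2, 1). If z, u ≥ 0
-- it is too high, and if both are negative its height is at most -b. Mixed signs push f out of
-- (-f(5, 1), 0).
critical-noHit : ∀ {b a n} → 0ℤ ≤ b → 0ℤ < a → n + + 3 ≡ b * + 6 + a * + 2 →
  NoHit b a (+ 5) (+ 1) (+ 1) n
critical-noHit {b} {a} {n} b≥0 a>0 n≡ {y} {e} (z , eq) N P low high =
  cases (<-≥-cases z 0ℤ) (<-≥-cases u 0ℤ)
  where
  u : ℤ
  u = e - + 2 - z

  y≡ : y ≡ + 6 + (z * + 5 + u * + 2)
  y≡ = trans eq (critical-coordinate z e)

  h≡ : b * y + a * e ≡ b * + 6 + a * + 2 + (z * (b * + 5 + a * + 1) + u * (b * + 2 + a * + 1))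
  h≡ = trans (cong (λ y → b * y + a * e) eq) (critical-height b a z e)

  r≥0 = 5b+a≥0 b≥0 a>0
  v≥0 = 2b+a≥0 b≥0 a>0

  cases : z < 0ℤ ⊎ 0ℤ ≤ z → u < 0ℤ ⊎ 0ℤ ≤ u → ⊥
  cases (inj₂ p) (inj₂ q) = ℤₚ.<⇒≱ (subst (_< b * + 6 + a * + 2) h≡ (below-critical {n} n≡ high))
    (combination-high {h = b * + 6 + a * + 2} r≥0 v≥0 p q)
  cases (inj₂ p) (inj₁ q) = no-mixed-outside {z} {u} {+ 5} {+ 1} {+ 2} {+ 1} {+ 6} {+ 2}
    (unit literal) (unit literal) (unit literal) p q
    (Pos-resp N (cong -_ y≡) (cong -_ (critical-index z e)))
  cases (inj₁ p) (inj₂ q) = no-mixed-inside {z} {u} {+ 5} {+ 1} {+ 2} {+ 1} {+ 6} {+ 2}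
    (unit literal) (unit literal) (unit literal) p q
    (Pos-resp P (cong (_+ + 5) y≡) (cong (_+ + 1) (critical-index z e)))
  cases (inj₁ p) (inj₁ q) = ℤₚ.<⇒≱ (ℤₚ.<-trans (+<+ (ℕ.s≤s ℕ.z≤n)) (subst (+ 1 <_) h≡ low))
    (combination-low {h = b * + 6 + a * + 2} r≥0 v≥0 p q (6b+2a≤7b+2a a b≥0))

renormalise⁻¹ : ∀ b a w d {i n} → NoHit (+ 19 * b + + 6 * a) (+ 60 * b + + 19 * a) w d i n →
  NoHit b a (+ 19 * w + + 60 * d) (+ 6 * w + + 19 * d) i n
renormalise⁻¹ b a w d {i} {n} noHit {y} {e} (t , refl) N P p q = noHit
  (+ 31 * t - + 12 * e + + 20 , coset t e)
  (Pos-resp (Pos-M⁻² N) (neg (+ 19) (+ 60) y e) (neg (+ 19) (+ 6) e y))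
  (Pos-resp (Pos-M⁻² P) (sumy y e w d) (sume y e w d))
  (subst (i <_) (sym (height-M⁻² b a y e)) p)
  (subst (_≤ i + n + + 1) (sym (height-M⁻² b a y e)) q)
  where
  coset : ∀ t e → + 19 * (+ 3 * t + + 2 * e + + 2) - + 60 * e
    ≡ + 3 * (+ 31 * t - + 12 * e + + 20)
      + + 2 * (+ 19 * e - + 6 * (+ 3 * t + + 2 * e + + 2)) + + 2
  coset t e = solve (t ∷ e ∷ [])
  neg : ∀ k l y e → k * (- y) - l * (- e) ≡ - (k * y - l * e)
  neg k l y e = solve (k ∷ l ∷ y ∷ e ∷ [])
  sumy : ∀ y e w d → + 19 * (y + (+ 19 * w + + 60 * d)) - + 60 * (e + (+ 6 * w + + 19 * d))
    ≡ + 19 * y - + 60 * e + w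
  sumy y e w d = solve (y ∷ e ∷ w ∷ d ∷ [])
  sume : ∀ y e w d → + 19 * (e + (+ 6 * w + + 19 * d)) - + 6 * (y + (+ 19 * w + + 60 * d))
    ≡ + 19 * e - + 6 * y + d
  sume y e w d = solve (y ∷ e ∷ w ∷ d ∷ [])

-- The orbit of (0, 1), on which the norm is exactly 1 and b is unbounded. `descend` undoes the
-- renormalisations, so that the height of D at this level becomes an actual shift of indices.
record Even-level (k : ℕ) : Set where
  field
    b a : ℤ
    b≥k : + k ≤ b
    a>0 : 0ℤ < a
    norm : a * a ≡ + 10 * (b * b) + + 1
    descend : ∀ w d {i n} → Lattice w d → Pos w d → NoHit b a w d i n →
      ∃[ w′ ] ∃[ d′ ] Lattice w′ d′ × Pos w′ d′ × d′ ≡ b * w + a * d × NoHit (+ 0) (+ 1) w′ d′ i n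

even-level : ∀ k → Even-level k
even-level zero = record
  { b = + 0 ; a = + 1 ; b≥k = nonNeg 0 ; a>0 = +<+ (ℕ.s≤s ℕ.z≤n) ; norm = refl
  ; descend = λ w d D∈L D>0 noHit → w , d , D∈L , D>0 , sym (height₀ w d) , noHit }
even-level (suc k) = record
  { b = + 19 * b + + 6 * a
  ; a = + 60 * b + + 19 * a
  ; b≥k = larger {+ k} b≥k
  ; a>0 = by< (60 ⊛ b≥0 ⊕ 19 ⊛ <⇒diff a>0 ⊕ nonNeg 18) (eq₁ b a)
  ; norm = trans (eq₂ b a) (trans (cong (λ N → N + + 10 * (b′ * b′) - + 10 * (b * b)) norm)
                                  (eq₃ (+ 10 * (b′ * b′)) (+ 10 * (b * b))))
  ; descend = λ w d {i} {n} D∈L D>0 noHit →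
      let w′ , d′ , ∈L , >0 , eq , noHit′ = descend (+ 19 * w + + 60 * d) (+ 6 * w + + 19 * d) {i} {n}
            (lattice D∈L) (Pos-M² D>0) (renormalise⁻¹ b a w d {i} {n} noHit)
      in w′ , d′ , ∈L , >0 , trans eq (hM b a w d) , noHit′ }
  where
  open Even-level (even-level k)
  b′ = + 19 * b + + 6 * a
  b≥0 = ℤₚ.≤-trans (nonNeg k) b≥k
  larger : ∀ {m} → m ≤ b → + 1 + m ≤ + 19 * b + + 6 * a
  larger {m} p = by≤ (≤⇒diff p ⊕ 18 ⊛ b≥0 ⊕ 6 ⊛ <⇒diff a>0 ⊕ nonNeg 5) (eq b a m)
    where
    eq : ∀ b a m → + 19 * b + + 6 * a - (+ 1 + m)
      ≡ b - m + + 18 * b + + 6 * (a - (+ 1 + 0ℤ)) + + 5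
    eq b a m = solve (b ∷ a ∷ m ∷ [])
  eq₁ : ∀ b a → + 60 * b + + 19 * a - (+ 1 + 0ℤ) ≡ + 60 * b + + 19 * (a - (+ 1 + 0ℤ)) + + 18
  eq₁ b a = solve (b ∷ a ∷ [])
  eq₂ : ∀ b a → (+ 60 * b + + 19 * a) * (+ 60 * b + + 19 * a)
    ≡ a * a + + 10 * ((+ 19 * b + + 6 * a) * (+ 19 * b + + 6 * a)) - + 10 * (b * b)
  eq₂ b a = solve (b ∷ a ∷ [])
  eq₃ : ∀ x y → y + + 1 + x - y ≡ x + + 1
  eq₃ x y = solve (x ∷ y ∷ [])
  lattice : ∀ {w d} → Lattice w d → Lattice (+ 19 * w + + 60 * d) (+ 6 * w + + 19 * d)
  lattice {d = d} (t , refl) = + 7 * t + + 12 * d , eq t d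
    where
    eq : ∀ t d → + 19 * (+ 3 * t + + 2 * d) + + 60 * d
      ≡ + 3 * (+ 7 * t + + 12 * d) + + 2 * (+ 6 * (+ 3 * t + + 2 * d) + + 19 * d)
    eq t d = solve (t ∷ d ∷ [])
  hM : ∀ b a w d → b * (+ 19 * w + + 60 * d) + a * (+ 6 * w + + 19 * d)
    ≡ (+ 19 * b + + 6 * a) * w + (+ 60 * b + + 19 * a) * d
  hM b a w d = solve (b ∷ a ∷ w ∷ d ∷ [])

-- From the ceilings to the lattice

pos-2m+1 : ∀ m → + (2 ℕ.* m ℕ.+ 1) ≡ + 2 * + m + + 1
pos-2m+1 m = trans (ℤₚ.pos-+ (2 ℕ.* m) 1) (cong (_+ + 1) (ℤₚ.pos-* 2 m))

pos-suc : ∀ m → + suc m ≡ + m + + 1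
pos-suc m = cong +_ (ℕₚ.+-comm 1 m)

ceil-lower : ∀ c → IsCeilSeq c → ∀ m → Pos (+ 3 * c m + + 2 * + m + + 1) (+ m + + 1)
ceil-lower c ceil m = Pos-resp
  (square≥⇒Pos (+<+ (ℕ.s≤s ℕ.z≤n)) (proj₁ (proj₂ (ceil m))) (proj₂ (proj₂ (ceil m))))
  (trans (cong (λ N → + 3 * c m - - N) (pos-2m+1 m)) (eq (c m) (+ m)))
  (pos-suc m)
  where
  eq : ∀ k M → + 3 * k - - (+ 2 * M + + 1) ≡ + 3 * k + + 2 * M + + 1
  eq k M = solve (k ∷ M ∷ [])

ceil-upper : ∀ c → IsCeilSeq c → ∀ m → Neg (+ 3 * c m + + 2 * + m - + 2) (+ m + + 1)
ceil-upper c ceil m = Pos-resp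
  (square<⇒Neg (+<+ (ℕ.s≤s ℕ.z≤n)) (proj₁ (ceil m)))
  (cong -_ (trans (cong (λ N → + 3 * c m - + 3 - - N) (pos-2m+1 m)) (eq (c m) (+ m))))
  (cong -_ (pos-suc m))
  where
  eq : ∀ k M → + 3 * k - + 3 - - (+ 2 * M + + 1) ≡ + 3 * k + + 2 * M - + 2
  eq k M = solve (k ∷ M ∷ [])

no-integer-between : ∀ {k z x y} → 0ℤ < x → x ≡ + 3 * (k - z - + 1) → 0ℤ < y → y ≡ + 3 * (z - k + + 2) → ⊥
no-integer-between {k} {z} p refl q refl = contra
  (ℤₚ.*-cancelˡ-<-nonNeg (+ 3) p) (ℤₚ.*-cancelˡ-<-nonNeg (+ 3) q)
  where
  contra : 0ℤ < k - z - + 1 → 0ℤ < z - k + + 2 → ⊥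
  contra p q = by⊥ (<⇒diff p ⊕ <⇒diff q) (solve (k ∷ z ∷ []))

-- Let Q = (3k + 2M + 1, M + 1). A hit is negative, so it lies below Q > 0; its translate by D is
-- positive, so it lies above Q - 3, whose translate is negative. But Q - 3 and Q are neighbours in
-- the coset at this height.
ceil-noHit⁺ : ∀ {k M} → Pos (+ 3 * k + + 2 * M + + 1) (M + + 1) →
  ∀ t D z → Neg (+ 3 * (k + t) + + 2 * (M + D) - + 2) (M + D + + 1) →
  Neg (+ 3 * z + + 2 * (M + + 1) + + 2) (M + + 1) →
  Pos (+ 3 * z + + 2 * (M + + 1) + + 2 + (+ 3 * t + + 2 * D)) (M + + 1 + D) → ⊥
ceil-noHit⁺ {k} {M} lower t D z upper N P = no-integer-between {k} {z}
  (diff-positive lower N) (eq₁ k z M)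
  (diff-positive P (Pos-resp upper refl (cong -_ (eq₀ M D)))) (eq₂ k z M t D)
  where
  eq₀ : ∀ M D → M + D + + 1 ≡ M + + 1 + D
  eq₀ M D = solve (M ∷ D ∷ [])
  eq₁ : ∀ k z M → + 3 * k + + 2 * M + + 1 - (+ 3 * z + + 2 * (M + + 1) + + 2) ≡ + 3 * (k - z - + 1)
  eq₁ k z M = solve (k ∷ z ∷ M ∷ [])
  eq₂ : ∀ k z M t D → + 3 * z + + 2 * (M + + 1) + + 2 + (+ 3 * t + + 2 * D)
    - (+ 3 * (k + t) + + 2 * (M + D) - + 2) ≡ + 3 * (z - k + + 2)
  eq₂ k z M t D = solve (k ∷ z ∷ M ∷ t ∷ D ∷ [])

ceil-noHit⁻ : ∀ {k M} → Neg (+ 3 * k + + 2 * M - + 2) (M + + 1) →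
  ∀ t D z → Pos (+ 3 * (k + t) + + 2 * (M + D) + + 1) (M + D + + 1) →
  Pos (+ 3 * z + + 2 * (M + + 1) + + 2) (M + + 1) →
  Neg (+ 3 * z + + 2 * (M + + 1) + + 2 + (+ 3 * t + + 2 * D)) (M + + 1 + D) → ⊥
ceil-noHit⁻ {k} {M} upper t D z lower P N = no-integer-between {k} {z}
  (diff-positive (Pos-resp lower refl (eq₀ M D)) N) (eq₁ k z M t D)
  (diff-positive P upper) (eq₂ k z M)
  where
  eq₀ : ∀ M D → M + D + + 1 ≡ M + + 1 + D
  eq₀ M D = solve (M ∷ D ∷ [])
  eq₁ : ∀ k z M t D → + 3 * (k + t) + + 2 * (M + D) + + 1
    - (+ 3 * z + + 2 * (M + + 1) + + 2 + (+ 3 * t + + 2 * D)) ≡ + 3 * (k - z - + 1)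
  eq₁ k z M t D = solve (k ∷ z ∷ M ∷ t ∷ D ∷ [])
  eq₂ : ∀ k z M → + 3 * z + + 2 * (M + + 1) + + 2 - (+ 3 * k + + 2 * M - + 2) ≡ + 3 * (z - k + + 2)
  eq₂ k z M = solve (k ∷ z ∷ M ∷ [])

window-index : ∀ {i n e} → + i < e → e ≤ + i + + n + + 1 → ∃[ j ] j ℕ.≤ n × e ≡ + (i ℕ.+ j) + + 1
window-index {i} {n} {+ k} (+<+ i<k) (+≤+ k≤) = k ℕ.∸ suc i
  , ℕₚ.≤-trans (ℕₚ.∸-monoˡ-≤ (suc i) k≤)
      (ℕₚ.≤-reflexive (trans (cong (ℕ._∸ suc i) (ℕₚ.+-comm (i ℕ.+ n) 1)) (ℕₚ.m+n∸m≡n (suc i) n)))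
  , trans (cong +_ (sym (ℕₚ.m+[n∸m]≡n i<k))) (pos-suc _)

-- Letters are differences of `c`, so n equal letters make n + 1 ceilings differ by one constant.
-- This is why the window (i, i + n + 1] has n + 1 heights.
telescope : ∀ (c : ℕ → ℤ) u v {n} → (∀ j → j ℕ.< n → sturm c (u ℕ.+ j) ≡ sturm c (v ℕ.+ j)) →
  ∀ j → j ℕ.≤ n → c (v ℕ.+ j) ≡ c (u ℕ.+ j) + (c v - c u)
telescope c u v same zero _ = trans (cong c (ℕₚ.+-identityʳ v))
  (trans (sym (h+[i-h]≡i (c u) (c v))) (cong (λ k → c k + (c v - c u)) (sym (ℕₚ.+-identityʳ u))))
telescope c u v same (suc j) j<n = trans (cong c (ℕₚ.+-suc v j))
  (trans (step (c (u ℕ.+ j)) (c (suc (u ℕ.+ j))) (c v - c u) (telescope c u v same j (ℕₚ.<⇒≤ j<n)) (same j j<n))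
    (cong (λ k → c k + (c v - c u)) (sym (ℕₚ.+-suc u j))))
  where
  step : ∀ x x′ t {y y′} → y ≡ x + t → x′ - x ≡ y′ - y → y′ ≡ x′ + t
  step x x′ t {_} {y′} refl eq = trans (eq₁ x t y′)
    (trans (cong (λ s → s + (x + t)) (sym eq)) (eq₂ x x′ t))
    where
    eq₁ : ∀ x t y′ → y′ ≡ y′ - (x + t) + (x + t)
    eq₁ x t y′ = solve (x ∷ t ∷ y′ ∷ [])
    eq₂ : ∀ x x′ t → x′ - x + (x + t) ≡ x′ + t
    eq₂ x x′ t = solve (x ∷ x′ ∷ t ∷ [])

pos-[i+d]+j : ∀ i d j → + (i ℕ.+ d ℕ.+ j) ≡ + (i ℕ.+ j) + + d
pos-[i+d]+j i d j = cong +_ (trans (ℕₚ.+-assoc i d j)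
  (trans (cong (i ℕ.+_) (ℕₚ.+-comm d j)) (sym (ℕₚ.+-assoc i j d))))

periodic-bound : ∀ c → IsCeilSeq c → ∀ i d {n} → 1 ℕ.≤ i → 1 ℕ.≤ d → ∀ t →
  (∀ j → j ℕ.≤ n → c (i ℕ.+ d ℕ.+ j) ≡ c (i ℕ.+ j) + t) → Bound (+ i) (+ d) (+ n)
periodic-bound c ceil i d {n} i≥1 d≥1 t periodic =
  cases (Pos-cmp (+ 3 * t + + 2 * + d) (+ d))
  where
  lower : ∀ j → j ℕ.≤ n →
    Pos (+ 3 * (c (i ℕ.+ j) + t) + + 2 * (+ (i ℕ.+ j) + + d) + + 1)
    (+ (i ℕ.+ j) + + d + + 1)
  lower j j≤n = Pos-resp (ceil-lower c ceil (i ℕ.+ d ℕ.+ j))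
    (cong₂ (λ k M → + 3 * k + + 2 * M + + 1) (periodic j j≤n) (pos-[i+d]+j i d j))
    (cong (_+ + 1) (pos-[i+d]+j i d j))

  upper : ∀ j → j ℕ.≤ n →
    Neg (+ 3 * (c (i ℕ.+ j) + t) + + 2 * (+ (i ℕ.+ j) + + d) - + 2)
    (+ (i ℕ.+ j) + + d + + 1)
  upper j j≤n = Pos-resp (ceil-upper c ceil (i ℕ.+ d ℕ.+ j))
    (cong -_ (cong₂ (λ k M → + 3 * k + + 2 * M - + 2) (periodic j j≤n) (pos-[i+d]+j i d j)))
    (cong -_ (cong (_+ + 1) (pos-[i+d]+j i d j)))

  coset≡ : ∀ z M {y e} → y ≡ + 3 * z + + 2 * e + + 2 → e ≡ M + + 1 → y ≡ + 3 * z + + 2 * (M + + 1) + + 2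
  coset≡ _ _ refl refl = refl

  noHit⁺ : NoHit (+ 0) (+ 1) (+ 3 * t + + 2 * + d) (+ d) (+ i) (+ n)
  noHit⁺ {y} {e} (z , y≡) N P p q = hit (window-index {i} {n}
      (subst (+ i <_) (height₀ y e) p) (subst (_≤ + i + + n + + 1) (height₀ y e) q))
    where
    hit : ∃[ j ] j ℕ.≤ n × e ≡ + (i ℕ.+ j) + + 1 → ⊥
    hit (j , j≤n , e≡) =
      ceil-noHit⁺ {c (i ℕ.+ j)} {+ (i ℕ.+ j)} (ceil-lower c ceil (i ℕ.+ j)) t (+ d) z (upper j j≤n)
        (subst₂ Neg (coset≡ z (+ (i ℕ.+ j)) y≡ e≡) e≡ N)
        (subst₂ (λ y e → Pos (y + (+ 3 * t + + 2 * + d)) (e + + d)) (coset≡ z (+ (i ℕ.+ j)) y≡ e≡) e≡ P)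

  noHit⁻ : NoHit⁻ (+ 3 * t + + 2 * + d) (+ d) (+ i) (+ n)
  noHit⁻ {y} {e} (z , y≡) P N p q = hit (window-index {i} {n} p q)
    where
    hit : ∃[ j ] j ℕ.≤ n × e ≡ + (i ℕ.+ j) + + 1 → ⊥
    hit (j , j≤n , e≡) =
      ceil-noHit⁻ {c (i ℕ.+ j)} {+ (i ℕ.+ j)} (ceil-upper c ceil (i ℕ.+ j)) t (+ d) z (lower j j≤n)
        (subst₂ Pos (coset≡ z (+ (i ℕ.+ j)) y≡ e≡) e≡ P)
        (subst₂ (λ y e → Neg (y + (+ 3 * t + + 2 * + d)) (e + + d)) (coset≡ z (+ (i ℕ.+ j)) y≡ e≡) e≡ N)

  cases : Pos (+ 3 * t + + 2 * + d) (+ d) ⊎ Neg (+ 3 * t + + 2 * + d) (+ d) ⊎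
          (+ 3 * t + + 2 * + d ≡ 0ℤ × + d ≡ 0ℤ) → Bound (+ i) (+ d) (+ n)
  cases (inj₁ D>0) = bound⁺ (+ 3 * t + + 2 * + d) (+ d) {+ i} {+ n} (t , refl) (+<+ d≥1) (+<+ i≥1) D>0 noHit⁺
  cases (inj₂ (inj₁ D<0)) =
    bound⁻ (+ 3 * t + + 2 * + d) (+ d) {+ i} {+ n} (t , refl) (+<+ d≥1) (+<+ i≥1) D<0 noHit⁻
  cases (inj₂ (inj₂ (_ , d≡0))) = ⊥-elim (ℤₚ.<-irrefl (sym d≡0) (+<+ d≥1))

-- The lower bound for all repetitions

below-shift : ∀ p q → + 2 * p + + 3 * q ≡ + 2 * (p - q) + + 5 * q
below-shift p q = solve (p ∷ q ∷ [])

ratio-shift : ∀ {p q n m K} → m ≡ n + K → (p - q) * n < q * K → p * n < q * m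
ratio-shift {p} {q} {n} {_} {K} refl r = by< (<⇒diff r) (solve (p ∷ q ∷ n ∷ K ∷ []))

ratio-shift′ : ∀ {p q n m K} → m ≡ n + K → q * K < (p - q) * n → q * m < p * n
ratio-shift′ {p} {q} {n} {_} {K} refl r = by< (<⇒diff r) (solve (p ∷ q ∷ n ∷ K ∷ []))

lower-part : ∀ c → IsCeilSeq c → ∀ p q → 1 ℕ.≤ q → (+ 2 * p + + (3 ℕ.* q)) <√10· (2 ℕ.* q) →
  ∀ n m → 1 ℕ.≤ n → Occ (sturm c) n m → p * + n < + (q ℕ.* m)
lower-part c ceil p q q≥1 below n m n≥1 (i , i≥1 , i+n≤m , same) =
  subst (p * + n <_) (sym (ℤₚ.pos-* q m))
    (ratio-shift {p} {+ q} m≡ (Bound⇒ratio {+ i} {+ d} {+ n} {p - + q} {+ q} (+<+ n≥1) (+<+ i≥1) (+<+ d≥1) (+<+ q≥1) below′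
      (periodic-bound c ceil i d i≥1 d≥1 (c v - c i) periodic)))
  where
  v d : ℕ
  v = m ℕ.∸ n ℕ.+ 1
  d = v ℕ.∸ i

  i<v : i ℕ.< v
  i<v = subst (suc i ℕ.≤_) (ℕₚ.+-comm 1 (m ℕ.∸ n)) (ℕ.s≤s
    (subst (ℕ._≤ m ℕ.∸ n) (ℕₚ.m+n∸n≡m i n) (ℕₚ.∸-monoˡ-≤ n i+n≤m)))

  d≥1 : 1 ℕ.≤ d
  d≥1 = ℕₚ.m<n⇒0<n∸m i<v

  i+d≡v : i ℕ.+ d ≡ v
  i+d≡v = ℕₚ.m+[n∸m]≡n (ℕₚ.<⇒≤ i<v)

  periodic : ∀ j → j ℕ.≤ n → c (i ℕ.+ d ℕ.+ j) ≡ c (i ℕ.+ j) + (c v - c i)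
  periodic j j≤n = trans (cong (λ k → c (k ℕ.+ j)) i+d≡v) (telescope c i v same j j≤n)

  -- The second occurrence starts at v = i + d and ends at m, so m/n - 1 = (i + d - 1)/n; hence the
  -- passage from p to p - q.
  m≡ : + m ≡ + n + (+ i + + d - + 1)
  m≡ = trans (cong +_ (sym (ℕₚ.m+[n∸m]≡n (ℕₚ.≤-trans (ℕₚ.m≤n+m n i) i+n≤m))))
    (cong (λ k → + n + k) (trans (eq (+ (m ℕ.∸ n))) (cong (λ k → + k - + 1) (sym i+d≡v))))
    where
    eq : ∀ k → k ≡ k + + 1 - + 1
    eq k = solve (k ∷ [])

  u≡ : + 2 * p + + (3 ℕ.* q) ≡ + 2 * (p - + q) + + 5 * + q
  u≡ = trans (cong (λ k → + 2 * p + k) (ℤₚ.pos-* 3 q)) (below-shift p (+ q))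

  below′ : Below (p - + q) (+ q)
  below′ = subst₂ (λ u a → u < 0ℤ ⊎ u * u < + 10 * (a * a)) u≡ (ℤₚ.pos-* 2 q) below

-- Existence of r(n)

least-fuel : ∀ {P : ℕ → Set} → Decidable P → ∀ f n → n ℕ.< f → P n →
  ∃[ m ] m ℕ.≤ n × P m × (∀ m′ → P m′ → m ℕ.≤ m′)
least-fuel P? (suc f) n (ℕ.s≤s n≤f) p with ℕₚ.anyUpTo? P? n
... | no none = n , ℕₚ.≤-refl , p , λ m′ p′ → ℕₚ.≮⇒≥ λ m′<n → none (m′ , m′<n , p′)
... | yes (k , k<n , pk) =
  let m , m≤k , pm , min = least-fuel P? f k (ℕₚ.<-≤-trans k<n n≤f) pk
  in m , ℕₚ.≤-trans m≤k (ℕₚ.<⇒≤ k<n) , pm , min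

least : ∀ {P : ℕ → Set} → Decidable P → ∀ n → P n →
  ∃[ m ] m ℕ.≤ n × P m × (∀ m′ → P m′ → m ℕ.≤ m′)
least P? n = least-fuel P? (suc n) n ℕₚ.≤-refl

Occ? : ∀ (x : ℕ → ℤ) n → Decidable (Occ x n)
Occ? x n m = map′
  (λ (i , _ , i≥1 , i+n≤m , same) → i , i≥1 , i+n≤m , λ j → same {j})
  (λ (i , i≥1 , i+n≤m , same) →
    i , ℕ.s≤s (ℕₚ.≤-trans (ℕₚ.m≤m+n i n) i+n≤m) , i≥1 , i+n≤m , λ {j} → same j)
  (ℕₚ.anyUpTo? (λ i → (1 ℕₚ.≤? i) ×-dec ((i ℕ.+ n ℕₚ.≤? m) ×-dec
      ℕₚ.allUpTo? (λ j → x (i ℕ.+ j) ℤₚ.≟ x (m ℕ.∸ n ℕ.+ 1 ℕ.+ j)) n)) (suc m))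

-- A constructed repetition only bounds r(n) from above; the exact value comes from a bounded
-- search, since `Occ` is decidable.
IsR-exists : ∀ (x : ℕ → ℤ) n m → Occ x n m → ∃[ m′ ] m′ ℕ.≤ m × IsR x n m′
IsR-exists x n m occ with least (Occ? x n) m occ
... | m′ , m′≤m , occ′@(i , i≥1 , i+n≤m′ , _) , min =
  m′ , m′≤m , ℕₚ.≤-trans i≥1 (ℕₚ.≤-trans (ℕₚ.m≤m+n i n) i+n≤m′) , occ′ , λ k _ → min k

-- From the absence of hits back to repetitions

-- With Q as the point of the ceiling at M, Q + D is positive and Q - 3 + D is negative. So f(Q + D)
-- lies in (0, 3), which determines the ceiling at M + D.
ceil-shift : ∀ {k k′ t M D} →
  Pos (+ 3 * k + + 2 * M + + 1) (M + + 1) → Neg (+ 3 * k′ + + 2 * (M + D) - + 2) (M + D + + 1) →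
  Pos (+ 3 * k′ + + 2 * (M + D) + + 1) (M + D + + 1) →
  Pos (+ 3 * t + + 2 * D) D →
  Neg (+ 3 * k + + 2 * M - + 2 + (+ 3 * t + + 2 * D)) (M + + 1 + D) → k′ ≡ k + t
ceil-shift {k} {k′} {t} {M} {D} lower upper′ lower′ D>0 N = ℤₚ.≤-antisym
  (below k k′ t (subst (0ℤ <_) (eq₁ k k′ t M D)
    (diff-positive (Pos-+ lower D>0) (Pos-resp upper′ refl (cong -_ (eq₀ M D))))))
  (above k k′ t (subst (0ℤ <_) (eq₂ k k′ t M D)
    (diff-positive (Pos-resp lower′ refl (eq₀ M D)) N)))
  where
  eq₀ : ∀ M D → M + D + + 1 ≡ M + + 1 + D
  eq₀ M D = solve (M ∷ D ∷ [])
  eq₁ : ∀ k k′ t M D → + 3 * k + + 2 * M + + 1 + (+ 3 * t + + 2 * D)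
    - (+ 3 * k′ + + 2 * (M + D) - + 2) ≡ + 3 * (k + t - k′ + + 1)
  eq₁ k k′ t M D = solve (k ∷ k′ ∷ t ∷ M ∷ D ∷ [])
  eq₂ : ∀ k k′ t M D → + 3 * k′ + + 2 * (M + D) + + 1
    - (+ 3 * k + + 2 * M - + 2 + (+ 3 * t + + 2 * D)) ≡ + 3 * (k′ - (k + t) + + 1)
  eq₂ k k′ t M D = solve (k ∷ k′ ∷ t ∷ M ∷ D ∷ [])
  below : ∀ k k′ t → 0ℤ < + 3 * (k + t - k′ + + 1) → k′ ≤ k + t
  below k k′ t p = lemma (ℤₚ.*-cancelˡ-<-nonNeg (+ 3) p)
    where
    lemma : 0ℤ < k + t - k′ + + 1 → k′ ≤ k + t
    lemma q = by≤ (<⇒diff q) (solve (k ∷ k′ ∷ t ∷ []))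
  above : ∀ k k′ t → 0ℤ < + 3 * (k′ - (k + t) + + 1) → k + t ≤ k′
  above k k′ t p = lemma (ℤₚ.*-cancelˡ-<-nonNeg (+ 3) p)
    where
    lemma : 0ℤ < k′ - (k + t) + + 1 → k + t ≤ k′
    lemma q = by≤ (<⇒diff q) (solve (k ∷ k′ ∷ t ∷ []))

coset-below : ∀ k M → + 3 * k + + 2 * M - + 2 ≡ + 3 * (k - + 2) + + 2 * (M + + 1) + + 2
coset-below k M = solve (k ∷ M ∷ [])

-- The point tested is Q - 3, the highest negative coset point at height m + 1. Were its translate
-- by D positive, it would be a hit; the heights m + 1 for 1 ≤ m ≤ n + 1 fill exactly the window (1,
-- n + 2].
noHit⇒periodic : ∀ c → IsCeilSeq c → ∀ t d {n} → Pos (+ 3 * t + + 2 * + d) (+ d) →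
  NoHit (+ 0) (+ 1) (+ 3 * t + + 2 * + d) (+ d) (+ 1) (+ n) →
  ∀ m → 1 ℕ.≤ m → m ℕ.≤ suc n → c (m ℕ.+ d) ≡ c m + t
noHit⇒periodic c ceil t d {n} D>0 noHit m m≥1 m≤ = cases
  (Coset-sign (Coset-+ {y} {+ m + + 1} {+ 3 * t + + 2 * + d} {+ d} coset D∈L))
  where
  y : ℤ
  y = + 3 * c m + + 2 * + m - + 2

  D∈L : Lattice (+ 3 * t + + 2 * + d) (+ d)
  D∈L = t , refl

  coset : Coset y (+ m + + 1)
  coset = c m - + 2 , coset-below (c m) (+ m)

  cases : Pos (y + (+ 3 * t + + 2 * + d)) (+ m + + 1 + + d) ⊎
          Neg (y + (+ 3 * t + + 2 * + d)) (+ m + + 1 + + d) → c (m ℕ.+ d) ≡ c m + t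
  cases (inj₂ N) = ceil-shift {c m} {c (m ℕ.+ d)} {t} {+ m} {+ d}
    (ceil-lower c ceil m) (ceil-upper c ceil (m ℕ.+ d)) (ceil-lower c ceil (m ℕ.+ d)) D>0 N
  cases (inj₁ P) = ⊥-elim (noHit coset (ceil-upper c ceil m) P
    (subst (+ 1 <_) (sym (height₀ y (+ m + + 1))) (+<+ (subst (2 ℕ.≤_) (ℕₚ.+-comm 1 m) (ℕ.s≤s m≥1))))
    (subst (_≤ + 1 + + n + + 1) (sym (height₀ y (+ m + + 1))) (+≤+ (ℕₚ.+-monoˡ-≤ 1 m≤))))

periodic⇒Occ : ∀ c t d {n} → 1 ℕ.≤ d → (∀ m → 1 ℕ.≤ m → m ℕ.≤ suc n → c (m ℕ.+ d) ≡ c m + t) →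
  Occ (sturm c) n (n ℕ.+ d)
periodic⇒Occ c t d {n} d≥1 periodic =
  1 , ℕₚ.≤-refl ,
  ℕₚ.≤-trans (ℕₚ.+-monoˡ-≤ n d≥1) (ℕₚ.≤-reflexive (ℕₚ.+-comm d n)) , same
  where
  cancel : ∀ x y t → x - y ≡ x + t - (y + t)
  cancel x y t = solve (x ∷ y ∷ t ∷ [])

  index : ∀ j → suc j ℕ.+ d ≡ n ℕ.+ d ℕ.∸ n ℕ.+ 1 ℕ.+ j
  index j = trans (ℕₚ.+-comm (suc j) d) (trans (sym (ℕₚ.+-assoc d 1 j))
    (cong (λ k → k ℕ.+ 1 ℕ.+ j) (sym (ℕₚ.m+n∸m≡n n d))))

  same : ∀ j → j ℕ.< n → sturm c (1 ℕ.+ j) ≡ sturm c (n ℕ.+ d ℕ.∸ n ℕ.+ 1 ℕ.+ j)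
  same j j<n = trans (cancel (c (suc (suc j))) (c (suc j)) t)
    (trans (cong₂ _-_
        (sym (periodic (suc (suc j)) (ℕ.s≤s ℕ.z≤n) (ℕ.s≤s j<n)))
        (sym (periodic (suc j) (ℕ.s≤s ℕ.z≤n) (ℕₚ.m≤n⇒m≤1+n j<n))))
      (cong (sturm c) (index j)))

-- The upper bound along the critical family

-- With norm exactly 1 the form equals 240b + 120a - 151. It is linear, hence bounded by a multiple
-- of X = 6b + 2a - 3.
critical-form : ∀ {b a} → + 1 ≤ b → 0ℤ < a → a * a ≡ + 10 * (b * b) + + 1 →
  + 4 * ((b * + 5 + a * + 1) * (b * + 5 + a * + 1))
  + + 20 * ((b * + 6 + a * + 2 - + 3) * (b * + 5 + a * + 1))
  - + 15 * ((b * + 6 + a * + 2 - + 3) * (b * + 6 + a * + 2 - + 3)) ≤ + 121 * (b * + 6 + a * + 2 - + 3)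
critical-form {b} {a} b≥1 a>0 norm =
  by≤ (16 ⊛ ≤⇒diff (ℤₚ.≤-reflexive (sym norm)) ⊕ 486 ⊛ ≤⇒diff b≥1 ⊕ 122 ⊛ <⇒diff a>0 ⊕ nonNeg 396)
    (solve (b ∷ a ∷ []))

critical-large : ∀ {b a k} → + 1 + k ≤ b → 0ℤ < a → 0ℤ ≤ k → k < b * + 6 + a * + 2 - + 3
critical-large {b} {a} {k} p a>0 k≥0 =
  by< (6 ⊛ ≤⇒diff p ⊕ 2 ⊛ <⇒diff a>0 ⊕ 5 ⊛ k≥0 ⊕ nonNeg 4) (solve (b ∷ a ∷ k ∷ []))

5b+a>0 : ∀ {b a} → 0ℤ ≤ b → 0ℤ < a → 0ℤ < b * + 5 + a * + 1
5b+a>0 {b} {a} b≥0 a>0 = by< (5 ⊛ b≥0 ⊕ <⇒diff a>0) (solve (b ∷ a ∷ []))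

X-3+3 : ∀ b a → b * + 6 + a * + 2 - + 3 + + 3 ≡ b * + 6 + a * + 2
X-3+3 b a = solve (b ∷ a ∷ [])

critical-Occ : ∀ c → IsCeilSeq c → ∀ {b a} n d → + n ≡ b * + 6 + a * + 2 - + 3 → + d ≡ b * + 5 + a * + 1 →
  1 ℕ.≤ d →
  (∃[ w ] ∃[ d′ ] Lattice w d′ × Pos w d′ × d′ ≡ b * + 5 + a * + 1 × NoHit (+ 0) (+ 1) w d′ (+ 1) (+ n)) →
  Occ (sturm c) n (n ℕ.+ d)
critical-Occ c ceil n d n≡ d≡ d≥1 (w , d′ , (t , w≡) , D>0 , d′≡ , noHit) =
  periodic⇒Occ c t d d≥1 (noHit⇒periodic c ceil t d
    (subst₂ Pos w≡′ d′≡d D>0)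
    (subst₂ (λ w d → NoHit (+ 0) (+ 1) w d (+ 1) (+ n)) w≡′ d′≡d noHit))
  where
  d′≡d : d′ ≡ + d
  d′≡d = trans d′≡ (sym d≡)
  w≡′ : w ≡ + 3 * t + + 2 * + d
  w≡′ = trans w≡ (cong (λ e → + 3 * t + + 2 * e) d′≡d)

upper-part : ∀ c → IsCeilSeq c → ∀ p q → 1 ℕ.≤ q → (2 ℕ.* q) √10·< (+ 2 * p + + (3 ℕ.* q)) →
  ∀ N → ∃[ n ] N ℕ.≤ n × 1 ℕ.≤ n × ∃[ m ] Occ (sturm c) n m × + (q ℕ.* m) < p * + n
upper-part c ceil p q q≥1 (u≥0 , above) N =
    n , ℕₚ.≤-trans (ℕₚ.m≤n+m N _) K≤n , ℕₚ.≤-trans (ℕ.s≤s ℕ.z≤n) K<n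
  , n ℕ.+ d
  , critical-Occ c ceil {b} {a} n d n≡ d≡ (ℤₚ.drop‿+<+ (subst (0ℤ <_) (sym d≡) Y>0))
      (descend (+ 5) (+ 1) {+ 1} {+ n} (+ 1 , refl) (unit literal)
        (critical-noHit {b} {a} {+ n} b≥0 a>0 (trans (cong (_+ + 3) n≡) (X-3+3 b a))))
  , subst (_< p * + n) (sym (ℤₚ.pos-* q (n ℕ.+ d)))
      (ratio-shift′ {p} {+ q} {+ n} {+ (n ℕ.+ d)} {+ d} refl
        (subst₂ (λ X Y → + q * Y < (p - + q) * X) (sym n≡) (sym d≡)
          (ratio-above {p - + q} {+ q} {X} {Y} (+<+ q≥1) (ℤₚ.<⇒≤ Y>0)
            (subst (0ℤ ≤_) u≡ u≥0)
            (subst₂ (λ u a → + 10 * (a * a) < u * u) u≡ (ℤₚ.pos-* 2 q) above)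
            (critical-form {b} {a} b≥1 a>0 norm)
            (ℤₚ.≤-<-trans (ℤₚ.≤-trans (ℤₚ.≤-reflexive q²≡) (+≤+ (ℕₚ.m≤m+n (121 ℕ.* (q ℕ.* q)) N))) X>K))))
  where
  -- The summand 121q² meets the size condition of `ratio-above`, and N makes n large enough;
  -- `critical-large` turns b ≥ 1 + K into X > K.
  K : ℕ
  K = 121 ℕ.* (q ℕ.* q) ℕ.+ N

  open Even-level (even-level (suc K))

  X Y : ℤ
  X = b * + 6 + a * + 2 - + 3
  Y = b * + 5 + a * + 1
  n d : ℕ
  n = ∣ X ∣
  d = ∣ Y ∣

  b≥0 : 0ℤ ≤ b
  b≥0 = ℤₚ.≤-trans (nonNeg (suc K)) b≥k
  b≥1 : + 1 ≤ b
  b≥1 = ℤₚ.≤-trans (+≤+ (ℕ.s≤s ℕ.z≤n)) b≥k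
  X>K : + K < X
  X>K = critical-large b≥k a>0 (nonNeg K)
  Y>0 : 0ℤ < Y
  Y>0 = 5b+a>0 b≥0 a>0
  n≡ : + n ≡ X
  n≡ = ℤₚ.0≤i⇒+∣i∣≡i (ℤₚ.≤-trans (nonNeg K) (ℤₚ.<⇒≤ X>K))
  d≡ : + d ≡ Y
  d≡ = ℤₚ.0≤i⇒+∣i∣≡i (ℤₚ.<⇒≤ Y>0)
  K<n : K ℕ.< n
  K<n = ℤₚ.drop‿+<+ (subst (+ K <_) (sym n≡) X>K)
  K≤n : K ℕ.≤ n
  K≤n = ℕₚ.<⇒≤ K<n
  q²≡ : + 121 * (+ q * + q) ≡ + (121 ℕ.* (q ℕ.* q))
  q²≡ = sym (trans (ℤₚ.pos-* 121 (q ℕ.* q)) (cong (_*_ (+ 121)) (ℤₚ.pos-* q q)))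
  u≡ : + 2 * p + + (3 ℕ.* q) ≡ + 2 * (p - + q) + + 5 * + q
  u≡ = trans (cong (λ k → + 2 * p + k) (ℤₚ.pos-* 3 q)) (below-shift p (+ q))

theorem3p5 : (c : ℕ → ℤ) → IsCeilSeq c → RepIsSqrt10MinusThreeHalves (sturm c)
theorem3p5 c ceil =
    -- The lower bound already holds for every n ≥ 1, hence the threshold 0.
    (λ p q q≥1 below → 0 , λ n _ n≥1 m (_ , occ , _) → lower-part c ceil p q q≥1 below n m n≥1 occ)
  , λ p q q≥1 above N →
      let n , N≤n , n≥1 , m , occ , m< = upper-part c ceil p q q≥1 above N
          m′ , m′≤m , r = IsR-exists (sturm c) n m occ
      in n , N≤n , n≥1 , m′ , r , ℤₚ.≤-<-trans (+≤+ (ℕₚ.*-monoʳ-≤ q m′≤m)) m<
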